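{- Let $A,B$ be nonempty subsets of a finite abelian group $G$. Suppose that for some $\varepsilon\in[0,\frac14]$ and some even integer $k\ge2$, both $A$ and $B$ are $(1+\varepsilon,\lceil k/\varepsilon\rceil)$-self-regular, i.e. $\|A\star A\|_{\lceil k/\varepsilon\rceil}\le1+\varepsilon$ and $\|B\star B\|_{\lceil k/\varepsilon\rceil}\le1+\varepsilon$. Then $$\|A*B-1\|_k\le2\varepsilon.$$ In particular, $|\langle A*B,C\rangle-1|\le K\varepsilon$ for any set $C\subseteq G$ of size $|C|\ge2^{ -k}|G|$, where $K$ is an absolute constant.
   Context: For a nonempty set $S\subseteq G$, the same letter denotes the density function $S(x)=\frac{|G|}{|S|}\mathbf{1}_S(x)$. For $f,g:G\to\mathbb{R}$: $\langle f,g\rangle=\mathbb{E}_{x\in G}f(x)g(x)$, $\|f\|_k=(\mathbb{E}_{x\in G}|f(x)|^k)^{1/k}$, $\|f\|_\infty=\max_x|f(x)|$, $(f*g)(x)=\mathbb{E}_{y\in G}f(y)g(x-y)$, $(f\star g)(x)=\mathbb{E}_{y\in G}f(y)g(x+y)$. The set $A$ is called $(\gamma,k)$-self-regular if $\|A\star A\|_k\le\gamma$. When $\varepsilon=0$, $\lceil k/\varepsilon\rceil$ is read as $\infty$. -}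

module Defs where

open import Level using (Level; _⊔_) renaming (suc to lsuc)
open import Algebra.Bundles using (AbelianGroup)
open import Data.Bool.Base using (if_then_else_)
open import Data.Fin.Base using (Fin)
open import Data.Fin.Properties using (nonZeroIndex)
open import Data.Fin.Subset using (Subset; Nonempty; ∣_∣; inside; outside)
open import Data.Integer.Base using (+_)
open import Data.Nat.Base as ℕ using (ℕ; zero; suc)
open import Data.Product.Base using (∃; _×_; _,_; proj₁; proj₂)
open import Data.Rational.Base as ℚ
  using (ℚ; 0ℚ; 1ℚ; _/_; _+_; _*_; -_; 1/_; _<_; _≤_; Positive; NonNegative)
import Data.Rational.Properties as ℚ
open import Data.Sum.Base using (_⊎_; inj₁; inj₂)
open import Data.Vec.Base using (lookup; _∷_; here; there)
open import Data.Vec.Functional using (Vector; foldr)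
open import Function.Base using (_∘_)
open import Function.Bundles using (Inverse)
open import Relation.Binary.Definitions using (tri<; tri≈; tri>)
open import Relation.Binary.PropositionalEquality
  using (_≡_; refl; sym; trans; cong; subst; subst₂)
import Relation.Binary.PropositionalEquality as ≡
open import Relation.Nullary.Decidable.Core using (yes; no)
open import Relation.Nullary.Negation.Core using (¬_)
open import Algebra.Definitions.RawSemiring ℚ.+-*-rawSemiring public
  using (_^_; sum)

fromℕ : ℕ → ℚ
fromℕ n = + n / 1

private
  pos : ∀ {q} → 0ℚ < q → Positive q
  pos = ℚ.positive

  nonNeg : ∀ {q} → 0ℚ ≤ q → NonNegative q
  nonNeg = ℚ.nonNegative

  *-mono-<-pos : ∀ q {a b} → 0ℚ < q → a < b → q * a < q * b
  *-mono-<-pos q 0<q = ℚ.*-monoʳ-<-pos q {{pos 0<q}}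

  quotient : ∀ q → ¬ q ≡ 0ℚ → ∀ m → ∃ λ r → q * r ≡ m
  quotient q q≢0 m = 1/ q * m , (begin
    q * (1/ q * m)  ≡⟨ ℚ.*-assoc q (1/ q) m ⟨
    q * 1/ q * m    ≡⟨ cong (_* m) (ℚ.*-inverseʳ q) ⟩
    1ℚ * m          ≡⟨ ℚ.*-identityˡ m ⟩
    m               ∎)
    where
      open ≡.≡-Reasoning
      instance
        nz : ℚ.NonZero q
        nz = ℚ.≢-nonZero q≢0

  quotient⁺ : ∀ q → 0ℚ < q → ∀ m → ∃ λ r → q * r ≡ m
  quotient⁺ q 0<q = quotient q (λ q≡0 → ℚ.<⇒≢ 0<q (sym q≡0))

  quotient⁻ : ∀ q → q < 0ℚ → ∀ m → ∃ λ r → q * r ≡ m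
  quotient⁻ q q<0 = quotient q (ℚ.<⇒≢ q<0)

  *-cancel-<-pos : ∀ q {a b} → 0ℚ < q → q * a < q * b → a < b
  *-cancel-<-pos q 0<q = ℚ.*-cancelˡ-<-nonNeg q {{nonNeg (ℚ.<⇒≤ 0<q)}}

  *-mono-<-neg : ∀ q {a b} → q < 0ℚ → a < b → q * b < q * a
  *-mono-<-neg q q<0 = ℚ.*-monoʳ-<-neg q {{ℚ.negative q<0}}

  *-cancel-<-neg : ∀ q {a b} → q < 0ℚ → q * b < q * a → a < b
  *-cancel-<-neg q q<0 = ℚ.*-cancelˡ-<-nonPos q {{ℚ.nonPositive (ℚ.<⇒≤ q<0)}}

  *-mono-≤-nonNeg : ∀ q {a b} → 0ℚ ≤ q → a ≤ b → q * a ≤ q * b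
  *-mono-≤-nonNeg q 0≤q = ℚ.*-monoˡ-≤-nonNeg q {{nonNeg 0≤q}}

  *-nonNeg : ∀ {a b} → 0ℚ ≤ a → 0ℚ ≤ b → 0ℚ ≤ a * b
  *-nonNeg {a} {b} 0≤a 0≤b = subst (_≤ a * b) (ℚ.*-zeroʳ a) (*-mono-≤-nonNeg a 0≤a 0≤b)

  ^-nonNeg : ∀ {a} p → 0ℚ ≤ a → 0ℚ ≤ a ^ p
  ^-nonNeg zero    0≤a = ℚ.<⇒≤ (ℚ.positive⁻¹ 1ℚ)
  ^-nonNeg (suc p) 0≤a = *-nonNeg 0≤a (^-nonNeg p 0≤a)

  ^-mono-≤ : ∀ {a b} p → 0ℚ ≤ a → a ≤ b → a ^ p ≤ b ^ p
  ^-mono-≤ zero _ _ = ℚ.≤-refl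
  ^-mono-≤ {a} {b} (suc p) 0≤a a≤b = ℚ.≤-trans
    (*-mono-≤-nonNeg a 0≤a (^-mono-≤ p 0≤a a≤b))
    (subst₂ _≤_ (ℚ.*-comm (b ^ p) a) (ℚ.*-comm (b ^ p) b)
      (*-mono-≤-nonNeg (b ^ p) (^-nonNeg p (ℚ.≤-trans 0≤a a≤b)) a≤b))

  ^-pos : ∀ {a} p → 0ℚ < a → 0ℚ < a ^ p
  ^-pos zero    0<a = ℚ.positive⁻¹ 1ℚ
  ^-pos {a} (suc p) 0<a = subst (_< a * a ^ p) (ℚ.*-zeroʳ a) (*-mono-<-pos a 0<a (^-pos p 0<a))

  ^-mono-< : ∀ {a b} p .{{_ : ℕ.NonZero p}} → 0ℚ ≤ a → a < b → a ^ p < b ^ p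
  ^-mono-< {a} {b} (suc p) 0≤a a<b = ℚ.≤-<-trans
    (*-mono-≤-nonNeg a 0≤a (^-mono-≤ p 0≤a (ℚ.<⇒≤ a<b)))
    (subst₂ _<_ (ℚ.*-comm (b ^ p) a) (ℚ.*-comm (b ^ p) b)
      (*-mono-<-pos (b ^ p) (^-pos p (ℚ.≤-<-trans 0≤a a<b)) a<b))

  0^p≡0 : ∀ p .{{_ : ℕ.NonZero p}} → 0ℚ ^ p ≡ 0ℚ
  0^p≡0 (suc p) = ℚ.*-zeroˡ (0ℚ ^ p)

  1≤^ : ∀ {a} p → 1ℚ ≤ a → 1ℚ ≤ a ^ p
  1≤^ zero    1≤a = ℚ.≤-refl
  1≤^ {a} (suc p) 1≤a = ℚ.≤-trans 1≤a (subst (_≤ a * a ^ p) (ℚ.*-identityʳ a)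
    (*-mono-≤-nonNeg a (ℚ.≤-trans (ℚ.<⇒≤ (ℚ.positive⁻¹ 1ℚ)) 1≤a) (1≤^ p 1≤a)))

  q<q+1 : ∀ q → q < q + 1ℚ
  q<q+1 q = subst (_< q + 1ℚ) (ℚ.+-identityʳ q) (ℚ.+-monoʳ-< q (ℚ.positive⁻¹ 1ℚ))

  q-1<q : ∀ q → q + - 1ℚ < q
  q-1<q q = subst (q + - 1ℚ <_) (ℚ.+-identityʳ q) (ℚ.+-monoʳ-< q (ℚ.negative⁻¹ (- 1ℚ)))

  [r-q]+q≡r : ∀ r q → r + - q + q ≡ r
  [r-q]+q≡r r q = trans (ℚ.+-assoc r (- q) q)
    (trans (cong (λ t → r + t) (ℚ.+-inverseˡ q)) (ℚ.+-identityʳ r))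

  [r+q]-q≡r : ∀ r q → r + q + - q ≡ r
  [r+q]-q≡r r q = trans (ℚ.+-assoc r q (- q))
    (trans (cong (λ t → r + t) (ℚ.+-inverseʳ q)) (ℚ.+-identityʳ r))

  below-both : ∀ {r a b} → r < a → r < b → ∃ λ r′ → r < r′ × r′ < a × r′ < b
  below-both {r} {a} {b} r<a r<b with ℚ.≤-total a b
  ... | inj₁ a≤b = let m , r<m , m<a = ℚ.<-dense r<a in m , r<m , m<a , ℚ.<-≤-trans m<a a≤b
  ... | inj₂ b≤a = let m , r<m , m<b = ℚ.<-dense r<b in m , r<m , ℚ.<-≤-trans m<b b≤a , m<b

  above-both : ∀ {r a b} → a < r → b < r → ∃ λ r′ → r′ < r × a < r′ × b < r′
  above-both {r} {a} {b} a<r b<r with ℚ.≤-total a b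
  ... | inj₁ a≤b = let m , b<m , m<r = ℚ.<-dense b<r in m , m<r , ℚ.≤-<-trans a≤b b<m , b<m
  ... | inj₂ b≤a = let m , a<m , m<r = ℚ.<-dense a<r in m , m<r , a<m , ℚ.≤-<-trans b≤a a<m

  dense₂ : ∀ {r r′} → r < r′ → ∃ λ m → ∃ λ m′ → r < m × m < m′ × m′ < r′
  dense₂ r<r′ =
    let m , r<m , m<r′ = ℚ.<-dense r<r′
        m′ , m<m′ , m′<r′ = ℚ.<-dense m<r′
    in m , m′ , r<m , m<m′ , m′<r′

------------------------------------------------------------------------
-- Dedekind reals: `lower x q` means q < x and `upper x q` means x < q.

record ℝ : Set₁ where
  no-eta-equality
  field
    lower upper     : ℚ → Set
    lower-inhabited : ∃ lower
    upper-inhabited : ∃ upper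
    lower-down      : ∀ {q r} → q < r → lower r → lower q
    upper-up        : ∀ {q r} → q < r → upper q → upper r
    lower-open      : ∀ {q} → lower q → ∃ λ r → q < r × lower r
    upper-open      : ∀ {r} → upper r → ∃ λ q → q < r × upper q
    lower<upper     : ∀ {q r} → lower q → upper r → q < r
    located         : ∀ {q r} → q < r → lower q ⊎ upper r

open ℝ public

infix 4 _<ᴿ_ _≤ᴿ_ _≈ᴿ_

_<ᴿ_ : ℝ → ℝ → Set
x <ᴿ y = ∃ λ q → upper x q × lower y q

_≤ᴿ_ : ℝ → ℝ → Set
x ≤ᴿ y = ∀ q → lower x q → lower y q

_≈ᴿ_ : ℝ → ℝ → Set
x ≈ᴿ y = x ≤ᴿ y × y ≤ᴿ x

fromℚ : ℚ → ℝ
fromℚ q = record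
  { lower           = _< q
  ; upper           = q <_
  ; lower-inhabited = q + - 1ℚ , q-1<q q
  ; upper-inhabited = q + 1ℚ , q<q+1 q
  ; lower-down      = ℚ.<-trans
  ; upper-up        = λ r<s q<r → ℚ.<-trans q<r r<s
  ; lower-open      = ℚ.<-dense
  ; upper-open      = λ q<r → let m , q<m , m<r = ℚ.<-dense q<r in m , m<r , q<m
  ; lower<upper     = ℚ.<-trans
  ; located         = loc
  }
  where
    loc : ∀ {r s} → r < s → r < q ⊎ q < s
    loc {r} r<s with r ℚ.<? q
    ... | yes r<q = inj₁ r<q
    ... | no  r≮q = inj₂ (ℚ.≤-<-trans (ℚ.≮⇒≥ r≮q) r<s)

0ᴿ : ℝ
0ᴿ = fromℚ 0ℚ

infixl 6 _+ᴿ_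
infixl 7 _*ᴿ_

-- Sum of a rational and a real number.
_+ᴿ_ : ℚ → ℝ → ℝ
q +ᴿ x = record
  { lower           = λ r → lower x (r + - q)
  ; upper           = λ r → upper x (r + - q)
  ; lower-inhabited = let r , l = lower-inhabited x in
      r + q , subst (lower x) (sym ([r+q]-q≡r r q)) l
  ; upper-inhabited = let r , u = upper-inhabited x in
      r + q , subst (upper x) (sym ([r+q]-q≡r r q)) u
  ; lower-down      = λ r<s → lower-down x (ℚ.+-monoˡ-< (- q) r<s)
  ; upper-up        = λ r<s → upper-up x (ℚ.+-monoˡ-< (- q) r<s)
  ; lower-open      = λ {r} l → let s , r-q<s , l′ = lower-open x l in
      s + q , subst (_< s + q) ([r-q]+q≡r r q) (ℚ.+-monoˡ-< q r-q<s)
            , subst (lower x) (sym ([r+q]-q≡r s q)) l′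
  ; upper-open      = λ {r} u → let s , s<r-q , u′ = upper-open x u in
      s + q , subst (s + q <_) ([r-q]+q≡r r q) (ℚ.+-monoˡ-< q s<r-q)
            , subst (upper x) (sym ([r+q]-q≡r s q)) u′
  ; lower<upper     = λ {r} {s} l u →
      subst₂ _<_ ([r-q]+q≡r r q) ([r-q]+q≡r s q) (ℚ.+-monoˡ-< q (lower<upper x l u))
  ; located         = λ r<s → located x (ℚ.+-monoˡ-< (- q) r<s)
  }

-- Product of a rational of arbitrary sign and a real number: for a < x < b,
-- the product q x lies between q a and q b, in whichever order these are.
_*ᴿ_ : ℚ → ℝ → ℝ
q *ᴿ x = record
  { lower           = L
  ; upper           = U
  ; lower-inhabited = let r , _ , r<qa , r<qb = below-both (both-below .proj₂ .proj₁) (both-below .proj₂ .proj₂)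
                      in r , a₀ , b₀ , la₀ , ub₀ , r<qa , r<qb
  ; upper-inhabited = let r , _ , qa<r , qb<r = above-both (both-above .proj₂ .proj₁) (both-above .proj₂ .proj₂)
                      in r , a₀ , b₀ , la₀ , ub₀ , qa<r , qb<r
  ; lower-down      = λ { r<s (a , b , la , ub , s<qa , s<qb) →
      a , b , la , ub , ℚ.<-trans r<s s<qa , ℚ.<-trans r<s s<qb }
  ; upper-up        = λ { r<s (a , b , la , ub , qa<r , qb<r) →
      a , b , la , ub , ℚ.<-trans qa<r r<s , ℚ.<-trans qb<r r<s }
  ; lower-open      = λ { (a , b , la , ub , r<qa , r<qb) →
      let r′ , r<r′ , r′<qa , r′<qb = below-both r<qa r<qb
      in r′ , r<r′ , a , b , la , ub , r′<qa , r′<qb }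
  ; upper-open      = λ { (a , b , la , ub , qa<r , qb<r) →
      let r′ , r′<r , qa<r′ , qb<r′ = above-both qa<r qb<r
      in r′ , r′<r , a , b , la , ub , qa<r′ , qb<r′ }
  ; lower<upper     = λ { (a , b , la , ub , r<qa , r<qb) (a′ , b′ , la′ , ub′ , qa′<s , qb′<s) →
      sep (lower<upper x la ub′) (lower<upper x la′ ub) r<qa r<qb qa′<s qb′<s }
  ; located         = loc
  }
  where
    L U : ℚ → Set
    L r = ∃ λ a → ∃ λ b → lower x a × upper x b × r < q * a × r < q * b
    U r = ∃ λ a → ∃ λ b → lower x a × upper x b × q * a < r × q * b < r

    a₀ b₀ : ℚ
    a₀ = lower-inhabited x .proj₁
    b₀ = upper-inhabited x .proj₁
    la₀ : lower x a₀
    la₀ = lower-inhabited x .proj₂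
    ub₀ : upper x b₀
    ub₀ = upper-inhabited x .proj₂

    both-below : ∃ λ r → r < q * a₀ × r < q * b₀
    both-below with ℚ.≤-total (q * a₀) (q * b₀)
    ... | inj₁ le = q * a₀ + - 1ℚ , q-1<q _ , ℚ.<-≤-trans (q-1<q _) le
    ... | inj₂ le = q * b₀ + - 1ℚ , ℚ.<-≤-trans (q-1<q _) le , q-1<q _

    both-above : ∃ λ r → q * a₀ < r × q * b₀ < r
    both-above with ℚ.≤-total (q * a₀) (q * b₀)
    ... | inj₁ le = q * b₀ + 1ℚ , ℚ.≤-<-trans le (q<q+1 _) , q<q+1 _
    ... | inj₂ le = q * a₀ + 1ℚ , q<q+1 _ , ℚ.≤-<-trans le (q<q+1 _)

    sep : ∀ {a b a′ b′ r s} → a < b′ → a′ < b →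
          r < q * a → r < q * b → q * a′ < s → q * b′ < s → r < s
    sep {a} {b} {a′} {b′} a<b′ a′<b r<qa r<qb qa′<s qb′<s with ℚ.≤-total 0ℚ q
    ... | inj₁ 0≤q = ℚ.<-trans r<qa (ℚ.≤-<-trans (*-mono-≤-nonNeg q 0≤q (ℚ.<⇒≤ a<b′)) qb′<s)
    ... | inj₂ q≤0 = ℚ.<-trans r<qb (ℚ.≤-<-trans
          (ℚ.*-monoˡ-≤-nonPos q {{ℚ.nonPositive q≤0}} (ℚ.<⇒≤ a′<b)) qa′<s)

    loc : ∀ {r s} → r < s → L r ⊎ U s
    loc {r} {s} r<s with ℚ.<-cmp q 0ℚ
    ... | tri≈ _ refl _ with r ℚ.<? 0ℚ
    ...   | yes r<0 = inj₁ (a₀ , b₀ , la₀ , ub₀ ,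
              subst (r <_) (sym (ℚ.*-zeroˡ a₀)) r<0 , subst (r <_) (sym (ℚ.*-zeroˡ b₀)) r<0)
    ...   | no  r≮0 = let 0<s = ℚ.≤-<-trans (ℚ.≮⇒≥ r≮0) r<s in inj₂ (a₀ , b₀ , la₀ , ub₀ ,
              subst (_< s) (sym (ℚ.*-zeroˡ a₀)) 0<s , subst (_< s) (sym (ℚ.*-zeroˡ b₀)) 0<s)
    loc {r} {s} r<s | tri> _ _ 0<q with dense₂ r<s
    ... | m , m′ , r<m , m<m′ , m′<s with quotient⁺ q 0<q m | quotient⁺ q 0<q m′
    ...   | a , refl | b , refl with located x (*-cancel-<-pos q 0<q m<m′)
    ...     | inj₁ la = inj₁ (a , b₀ , la , ub₀ , r<m ,
                ℚ.<-trans r<m (*-mono-<-pos q 0<q (lower<upper x la ub₀)))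
    ...     | inj₂ ub = inj₂ (a₀ , b , la₀ , ub ,
                ℚ.<-trans (*-mono-<-pos q 0<q (lower<upper x la₀ ub)) m′<s , m′<s)
    loc {r} {s} r<s | tri< q<0 _ _ with dense₂ r<s
    ... | m , m′ , r<m , m<m′ , m′<s with quotient⁻ q q<0 m | quotient⁻ q q<0 m′
    ...   | b , refl | a , refl with located x (*-cancel-<-neg q q<0 m<m′)
    ...     | inj₁ la = inj₂ (a , b₀ , la , ub₀ , m′<s ,
                ℚ.<-trans (*-mono-<-neg q q<0 (lower<upper x la ub₀)) m′<s)
    ...     | inj₂ ub = inj₁ (a₀ , b , la₀ , ub ,
                ℚ.<-trans r<m (*-mono-<-neg q q<0 (lower<upper x la₀ ub)) , r<m)

-- The quotient k / x of a positive integer and a positive real number.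
quotientᴿ : (k : ℕ) .{{_ : ℕ.NonZero k}} (x : ℝ) → 0ᴿ <ᴿ x → ℝ
quotientᴿ k x (z , 0<z , lz) = record
  { lower           = L
  ; upper           = U
  ; lower-inhabited = let s , us = upper-inhabited x in
      0ℚ , s , ℚ.<-trans 0<z (lower<upper x lz us) , us , subst (_< q) (sym (ℚ.*-zeroʳ s)) 0<q
  ; upper-inhabited = let r , zr≡q+1 = quotient⁺ z 0<z (q + 1ℚ) in
      r , z , 0<z , lz , subst (q <_) (sym zr≡q+1) (q<q+1 q)
  ; lower-down      = λ { r<r′ (s , 0<s , us , sr′<q) →
      s , 0<s , us , ℚ.<-trans (*-mono-<-pos s 0<s r<r′) sr′<q }
  ; upper-up        = λ { r<r′ (s , 0<s , ls , q<sr) →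
      s , 0<s , ls , ℚ.<-trans q<sr (*-mono-<-pos s 0<s r<r′) }
  ; lower-open      = λ { (s , 0<s , us , sr<q) → lo s 0<s us sr<q }
  ; upper-open      = λ { (s , 0<s , ls , q<sr) → uo s 0<s ls q<sr }
  ; lower<upper     = λ { (s , 0<s , us , sr<q) (s′ , 0<s′ , ls′ , q<s′r′) →
      sep 0<s 0<s′ (lower<upper x ls′ us) sr<q q<s′r′ }
  ; located         = loc
  }
  where
    q : ℚ
    q = fromℕ k

    0<q : 0ℚ < q
    0<q = ℚ.positive⁻¹ q {{ℚ.normalize-pos k 1}}

    L U : ℚ → Set
    L r = ∃ λ s → 0ℚ < s × upper x s × s * r < q
    U r = ∃ λ s → 0ℚ < s × lower x s × q < s * r

    lo : ∀ {r} s → 0ℚ < s → upper x s → s * r < q → ∃ λ r′ → r < r′ × L r′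
    lo s 0<s us sr<q with ℚ.<-dense sr<q
    ... | m , sr<m , m<q with quotient⁺ s 0<s m
    ...   | r′ , refl = r′ , *-cancel-<-pos s 0<s sr<m , s , 0<s , us , m<q

    uo : ∀ {r} s → 0ℚ < s → lower x s → q < s * r → ∃ λ r′ → r′ < r × U r′
    uo s 0<s ls q<sr with ℚ.<-dense q<sr
    ... | m , q<m , m<sr with quotient⁺ s 0<s m
    ...   | r′ , refl = r′ , *-cancel-<-pos s 0<s m<sr , s , 0<s , ls , q<m

    sep : ∀ {s s′ r r′} → 0ℚ < s → 0ℚ < s′ → s′ < s → s * r < q → q < s′ * r′ → r < r′
    sep {s} {s′} {r} {r′} 0<s 0<s′ s′<s sr<q q<s′r′ = *-cancel-<-pos s 0<s (ℚ.<-trans sr<q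
      (ℚ.<-trans q<s′r′ (subst₂ _<_ (ℚ.*-comm r′ s′) (ℚ.*-comm r′ s) (*-mono-<-pos r′ 0<r′ s′<s))))
      where
        0<r′ : 0ℚ < r′
        0<r′ = *-cancel-<-pos s′ 0<s′
          (subst (_< s′ * r′) (sym (ℚ.*-zeroʳ s′)) (ℚ.<-trans 0<q q<s′r′))

    loc : ∀ {r r′} → r < r′ → L r ⊎ U r′
    loc {r} {r′} r<r′ with r ℚ.≤? 0ℚ
    ... | yes r≤0 = let s , us = upper-inhabited x
                        0<s = ℚ.<-trans 0<z (lower<upper x lz us)
                    in inj₁ (s , 0<s , us , ℚ.≤-<-trans
                         (subst (s * r ≤_) (ℚ.*-zeroʳ s) (*-mono-≤-nonNeg s (ℚ.<⇒≤ 0<s) r≤0)) 0<q)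
    ... | no  r≰0 with ℚ.≰⇒> r≰0
    ... | 0<r with quotient⁺ r 0<r q | quotient⁺ r′ (ℚ.<-trans 0<r r<r′) q
    ... | t , rt≡q | t′ , r′t′≡q = go (dense₂ t′<t)
      where
        0<r′ : 0ℚ < r′
        0<r′ = ℚ.<-trans 0<r r<r′
        0<t′ : 0ℚ < t′
        0<t′ = *-cancel-<-pos r′ 0<r′ (subst₂ _<_ (sym (ℚ.*-zeroʳ r′)) (sym r′t′≡q) 0<q)
        t′<t : t′ < t
        t′<t = *-cancel-<-pos r 0<r (subst (r * t′ <_) (trans r′t′≡q (sym rt≡q))
          (subst₂ _<_ (ℚ.*-comm t′ r) (ℚ.*-comm t′ r′) (*-mono-<-pos t′ 0<t′ r<r′)))
        go : (∃ λ s → ∃ λ s′ → t′ < s × s < s′ × s′ < t) → L r ⊎ U r′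
        go (s , s′ , t′<s , s<s′ , s′<t) with located x s<s′
        ... | inj₁ ls = inj₂ (s , ℚ.<-trans 0<t′ t′<s , ls ,
                subst₂ _<_ r′t′≡q (ℚ.*-comm r′ s) (*-mono-<-pos r′ 0<r′ t′<s))
        ... | inj₂ us = inj₁ (s′ , ℚ.<-trans 0<t′ (ℚ.<-trans t′<s s<s′) , us ,
                subst₂ _<_ (ℚ.*-comm r s′) rt≡q (*-mono-<-pos r 0<r s′<t))

-- The real number q^{1/p}, as sup {s ≥ 0 : s^p ≤ q} = inf {s ≥ 0 : q ≤ s^p}.
root : (p : ℕ) .{{_ : ℕ.NonZero p}} (q : ℚ) → 0ℚ ≤ q → ℝ
root p q 0≤q = record
  { lower           = L
  ; upper           = U
  ; lower-inhabited = 0ℚ + - 1ℚ , 0ℚ , q-1<q 0ℚ , ℚ.≤-refl , 0^p≤q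
  ; upper-inhabited = q + 1ℚ + 1ℚ , q + 1ℚ , q<q+1 _ , ℚ.≤-trans 0≤q (ℚ.<⇒≤ (q<q+1 q)) , q≤[q+1]^p p
  ; lower-down      = λ { r<r′ (s , r′<s , h) → s , ℚ.<-trans r<r′ r′<s , h }
  ; upper-up        = λ { r<r′ (s , s<r , h) → s , ℚ.<-trans s<r r<r′ , h }
  ; lower-open      = λ { (s , r<s , h) → let m , r<m , m<s = ℚ.<-dense r<s in m , r<m , s , m<s , h }
  ; upper-open      = λ { (s , s<r , h) → let m , s<m , m<r = ℚ.<-dense s<r in m , m<r , s , s<m , h }
  ; lower<upper     = λ { (s , r<s , _ , s^p≤q) (s′ , s′<r′ , 0≤s′ , q≤s′^p) →
      ℚ.<-trans r<s (ℚ.≤-<-trans (sep 0≤s′ (ℚ.≤-trans s^p≤q q≤s′^p)) s′<r′) }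
  ; located         = loc
  }
  where
    L U : ℚ → Set
    L r = ∃ λ s → r < s × 0ℚ ≤ s × s ^ p ≤ q
    U r = ∃ λ s → s < r × 0ℚ ≤ s × q ≤ s ^ p

    0^p≤q : 0ℚ ^ p ≤ q
    0^p≤q = subst (_≤ q) (sym (0^p≡0 p)) 0≤q

    q≤[q+1]^p : ∀ p .{{_ : ℕ.NonZero p}} → q ≤ (q + 1ℚ) ^ p
    q≤[q+1]^p (suc p) = ℚ.≤-trans (ℚ.<⇒≤ (q<q+1 q))
      (subst (_≤ (q + 1ℚ) * (q + 1ℚ) ^ p) (ℚ.*-identityʳ (q + 1ℚ))
        (*-mono-≤-nonNeg (q + 1ℚ) (ℚ.≤-trans 0≤q (ℚ.<⇒≤ (q<q+1 q)))
          (1≤^ p (subst (_≤ q + 1ℚ) (ℚ.+-identityˡ 1ℚ) (ℚ.+-monoˡ-≤ 1ℚ 0≤q)))))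

    sep : ∀ {s s′} → 0ℚ ≤ s′ → s ^ p ≤ s′ ^ p → s ≤ s′
    sep 0≤s′ s^p≤s′^p = ℚ.≮⇒≥ λ s′<s →
      ℚ.<-irrefl refl (ℚ.<-≤-trans (^-mono-< p 0≤s′ s′<s) s^p≤s′^p)

    loc : ∀ {r r′} → r < r′ → L r ⊎ U r′
    loc {r} {r′} r<r′ with r ℚ.<? 0ℚ
    ... | yes r<0 = inj₁ (0ℚ , r<0 , ℚ.≤-refl , 0^p≤q)
    ... | no  r≮0 with ℚ.<-dense r<r′
    ...   | m , r<m , m<r′ with ℚ.≤-total (m ^ p) q
    ...     | inj₁ m^p≤q = inj₁ (m , r<m , ℚ.≤-trans (ℚ.≮⇒≥ r≮0) (ℚ.<⇒≤ r<m) , m^p≤q)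
    ...     | inj₂ q≤m^p = inj₂ (m , m<r′ , ℚ.≤-trans (ℚ.≮⇒≥ r≮0) (ℚ.<⇒≤ r<m) , q≤m^p)

IsCeiling : ℝ → ℕ → Set
IsCeiling x p = fromℚ (fromℕ p + - 1ℚ) <ᴿ x × x ≤ᴿ fromℚ (fromℕ p)

data Exponent : Set where
  fin : (p : ℕ) .{{_ : ℕ.NonZero p}} → Exponent
  ∞   : Exponent

-- IsCeilingOfRatio k ε p holds iff p = ⌈k / ε⌉, which is ∞ for ε = 0.
data IsCeilingOfRatio (k : ℕ) .{{_ : ℕ.NonZero k}} (ε : ℝ) : Exponent → Set where
  infinite : ε ≈ᴿ 0ᴿ → IsCeilingOfRatio k ε ∞
  finite   : ∀ {p} .{{_ : ℕ.NonZero p}} (0<ε : 0ᴿ <ᴿ ε) →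
             IsCeiling (quotientᴿ k ε 0<ε) p → IsCeilingOfRatio k ε (fin p)

------------------------------------------------------------------------

private
  nonempty⇒nonZero : ∀ {n} (S : Subset n) → Nonempty S → ℕ.NonZero ∣ S ∣
  nonempty⇒nonZero (inside  ∷ S) _                  = _
  nonempty⇒nonZero (outside ∷ S) (_ , there i∈S) = nonempty⇒nonZero S (_ , i∈S)

  sum-nonNeg : ∀ n (f : Vector ℚ n) → (∀ i → 0ℚ ≤ f i) → 0ℚ ≤ sum f
  sum-nonNeg zero    f 0≤f = ℚ.≤-refl
  sum-nonNeg (suc n) f 0≤f = ℚ.+-mono-≤ (0≤f Fin.zero) (sum-nonNeg n (f ∘ Fin.suc) (0≤f ∘ Fin.suc))

-- The convolution f * g is written f ⊛ g.
-- A subset of the group is given as a Subset of the set of indices of the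
-- enumeration. Density functions are rational-valued, so functions on the group
-- take values in ℚ, and real numbers only enter through the norms.
record FiniteAbelianGroup (c ℓ : Level) : Set (lsuc (c ⊔ ℓ)) where
  infixl 6 _-ᴳ_
  infixl 7 _⊛_ _⋆_

  field
    abelianGroup : AbelianGroup c ℓ
    order        : ℕ
    enumeration  : Inverse (AbelianGroup.setoid abelianGroup) (≡.setoid (Fin order))

  open AbelianGroup abelianGroup public
    using (Carrier) renaming (_∙_ to infixl 6 _+ᴳ_; ε to 0ᴳ; _⁻¹ to -ᴳ_)

  _-ᴳ_ : Carrier → Carrier → Carrier
  x -ᴳ y = x +ᴳ (-ᴳ y)

  index : Carrier → Fin order
  index = Inverse.to enumeration

  element : Fin order → Carrier
  element = Inverse.from enumeration

  instance
    order-nonZero : ℕ.NonZero order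
    order-nonZero = nonZeroIndex (index 0ᴳ)

  𝔼 : (Carrier → ℚ) → ℚ
  𝔼 f = (+ 1 / order) * sum (f ∘ element)

  density : (S : Subset order) → .(Nonempty S) → Carrier → ℚ
  density S S≢∅ x = if lookup S (index x)
    then (+ order / ∣ S ∣) {{nonempty⇒nonZero S S≢∅}} else 0ℚ

  ⟨_,_⟩ : (f g : Carrier → ℚ) → ℚ
  ⟨ f , g ⟩ = 𝔼 λ x → f x * g x

  _⊛_ : (f g : Carrier → ℚ) → Carrier → ℚ
  (f ⊛ g) x = 𝔼 λ y → f y * g (x -ᴳ y)

  _⋆_ : (f g : Carrier → ℚ) → Carrier → ℚ
  (f ⋆ g) x = 𝔼 λ y → f y * g (x +ᴳ y)

  ∥_∥ : (Carrier → ℚ) → Exponent → ℝ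
  ∥ f ∥ (fin p) = root p (𝔼 λ x → ℚ.∣ f x ∣ ^ p)
    (*-nonNeg (ℚ.nonNegative⁻¹ (+ 1 / order) {{ℚ.normalize-nonNeg 1 order}})
      (sum-nonNeg order _ λ i → ^-nonNeg p (ℚ.0≤∣p∣ (f (element i)))))
  ∥ f ∥ ∞ = fromℚ (foldr ℚ._⊔_ 0ℚ λ i → ℚ.∣ f (element i) ∣)

  SelfRegular : (S : Subset order) → .(Nonempty S) → ℝ → Exponent → Set
  SelfRegular S S≢∅ γ p = ∥ density S S≢∅ ⋆ density S S≢∅ ∥ p ≤ᴿ γ

module Submission where

-- With g = A - 1 and h = B - 1 one has A * B - 1 = g * h and A ⋆ A - 1 = g ⋆ g. Expanding
-- the k-th moments and averaging over simultaneous translations of (y₁, …, y_k) gives, for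
-- Φ g (y) = 𝔼ₓ Πᵢ g (x + yᵢ) and Φ⁻ h (y) = 𝔼ₓ Πᵢ h (x - yᵢ),
--   𝔼 (g ⋆ g)^k = 𝔼_y (Φ g)²,   𝔼 (h ⋆ h)^k = 𝔼_y (Φ⁻ h)²,   𝔼 (g * h)^k = 𝔼_y Φ g · Φ⁻ h.
-- So the moments of F = g ⋆ g are nonnegative, and by 2ab ≤ a² + b² it suffices to show
-- 𝔼 F^k ≤ (2ε)^k, and likewise for h. For p = ⌈k/ε⌉ the binomial expansion gives
-- C(p,k) 𝔼 F^k ≤ 𝔼 (1 + F)^p ≤ (1 + ε)^p, which leaves (1 + ε)^p ≤ C(p,k) (2ε)^k. As
-- (1 + ε)^p / ε^k decreases for k/p ≤ ε ≤ k/(p-1), the worst case is ε = k/p, which follows by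
-- induction on k from p ≥ 4k, i.e. from ε ≤ 1/4. For ε = 0 already 1 + 𝔼 F^k ≤ 𝔼 (1 + F)^k ≤ 1.
-- The bound for sets C follows by Jensen's inequality, with K = 4. To stay within the
-- rationals, ε is replaced by an arbitrary rational e > ε.

open import Data.Nat.Base as ℕ using (ℕ; zero; suc; NonZero)
open import Data.Nat.Combinatorics using (nCk≡nC[n∸k]; nCn≡1; nC1≡n; nCk+nC[k+1]≡[n+1]C[k+1])
  renaming (_C_ to _choose_)
open import Data.Nat.Divisibility using (_∣_; divides)
import Data.Nat.Properties as ℕ
open import Data.Nat.Tactic.RingSolver using (solve-∀)
open import Data.Product.Base using (∃; Σ-syntax; _×_; _,_)
open import Data.Unit.Base using (tt)
open import Relation.Binary.PropositionalEquality
open import Relation.Nullary.Decidable using (toWitness)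
open import Relation.Nullary.Negation using (contradiction; ¬_)

-- Natural-number inequalities for powers and binomial coefficients.

module BinomialInequality where
  open import Data.Nat.Base
  open import Data.Nat.Properties
  open ≤-Reasoning

  ^-distribʳ-* : ∀ n a b → (a * b) ^ n ≡ a ^ n * b ^ n
  ^-distribʳ-* zero    a b = refl
  ^-distribʳ-* (suc n) a b = trans (cong (a * b *_) (^-distribʳ-* n a b)) (eq a b (a ^ n) (b ^ n))
    where
      eq : ∀ a b x y → a * b * (x * y) ≡ a * x * (b * y)
      eq = solve-∀

  -- Bernoulli's inequality 1 + m/a ≤ (1 + 1/a)^m, multiplied by a^(m+1).
  bernoulli : ∀ a m → a ^ m * (a + m) ≤ a * suc a ^ m
  bernoulli a zero    = ≤-reflexive (eq a)
    where
      eq : ∀ a → 1 * (a + 0) ≡ a * 1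
      eq = solve-∀
  bernoulli a (suc m) = begin
    a * a ^ m * (a + suc m)              ≤⟨ m≤m+n _ (a ^ m * m) ⟩
    a * a ^ m * (a + suc m) + a ^ m * m  ≡⟨ eq₁ a m (a ^ m) ⟩
    suc a * (a ^ m * (a + m))            ≤⟨ *-monoʳ-≤ (suc a) (bernoulli a m) ⟩
    suc a * (a * suc a ^ m)              ≡⟨ eq₂ a (suc a ^ m) ⟩
    a * (suc a * suc a ^ m)              ∎
    where
      eq₁ : ∀ a m x → a * x * (a + suc m) + x * m ≡ suc a * (x * (a + m))
      eq₁ = solve-∀
      eq₂ : ∀ a x → suc a * (a * x) ≡ a * (suc a * x)
      eq₂ = solve-∀

  2n^n≤[1+n]^n : ∀ n .{{_ : NonZero n}} → 2 * n ^ n ≤ suc n ^ n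
  2n^n≤[1+n]^n n = *-cancelˡ-≤ n (begin
    n * (2 * n ^ n)  ≡⟨ eq n (n ^ n) ⟩
    n ^ n * (n + n)  ≤⟨ bernoulli n n ⟩
    n * suc n ^ n    ∎)
    where
      eq : ∀ n x → n * (2 * x) ≡ x * (n + n)
      eq = solve-∀

  -- Cleared of denominators: if (1 + 1/n)^(n+1) ≤ c / d then (1 + 1/(n+1))^(n+2) ≤ c / d.
  decreasing-step : ∀ c d n .{{_ : NonZero n}} →
    d * suc n ^ suc n ≤ c * n ^ suc n →
    d * suc (suc n) ^ suc (suc n) ≤ c * suc n ^ suc (suc n)
  decreasing-step c d n hyp = *-cancelˡ-≤ (Q * b) {{m*n≢0 Q b {{m^n≢0 n m}} {{b≢0}}}} (begin
    Q * b * (d * (suc (suc n) * R))  ≡⟨ eq₁ Q b d (2 + n) R ⟩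
    d * (2 + n) * (Q * R * b)        ≡⟨ cong (λ t → d * (2 + n) * (t * b)) (^-distribʳ-* m n (2 + n)) ⟨
    d * (2 + n) * (a ^ m * (a + m))  ≤⟨ *-monoʳ-≤ (d * (2 + n)) (bernoulli a m) ⟩
    d * (2 + n) * (a * suc a ^ m)    ≡⟨ cong (λ t → d * (2 + n) * (a * t ^ m)) (eq₂ n) ⟩
    d * (2 + n) * (a * (m * m) ^ m)  ≡⟨ cong (λ t → d * (2 + n) * (a * t)) (^-distribʳ-* m m m) ⟩
    d * (2 + n) * (a * (P * P))      ≡⟨ eq₃ d (2 + n) a P ⟩
    d * P * ((2 + n) * a * P)        ≤⟨ *-monoˡ-≤ ((2 + n) * a * P) hyp ⟩
    c * Q * ((2 + n) * a * P)        ≤⟨ *-monoʳ-≤ (c * Q) (*-monoˡ-≤ P le) ⟩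
    c * Q * (suc n * b * P)          ≡⟨ eq₄ c Q (suc n) b P ⟩
    Q * b * (c * (suc n * P))        ∎)
    where
      m = suc n
      -- With this choice a + 1 = (n + 1)², so Bernoulli's inequality at a compares n^m (n + 2)^m
      -- with (n + 1)^(2m).
      a = n * (2 + n)
      b = a + m
      P = suc n ^ m
      Q = n ^ m
      R = (2 + n) ^ m
      b≢0 : NonZero b
      b≢0 = >-nonZero (≤-trans (s≤s z≤n) (m≤n+m m a))
      eq₁ : ∀ Q b d x R → Q * b * (d * (x * R)) ≡ d * x * (Q * R * b)
      eq₁ = solve-∀
      eq₂ : ∀ n → suc (n * (2 + n)) ≡ suc n * suc n
      eq₂ = solve-∀
      eq₃ : ∀ d x a P → d * x * (a * (P * P)) ≡ d * P * (x * a * P)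
      eq₃ = solve-∀
      eq₄ : ∀ c Q x b P → c * Q * (x * b * P) ≡ Q * b * (c * (x * P))
      eq₄ = solve-∀
      eq₅ : ∀ n → (2 + n) * (n * (2 + n)) + 1 ≡ suc n * (n * (2 + n) + suc n)
      eq₅ = solve-∀
      le : (2 + n) * a ≤ suc n * b
      le = ≤-trans (m≤m+n _ 1) (≤-reflexive (eq₅ n))

  decreasing : ∀ c d n₀ .{{_ : NonZero n₀}} → d * suc n₀ ^ suc n₀ ≤ c * n₀ ^ suc n₀ →
    ∀ {n} → n₀ ≤ n → d * suc n ^ suc n ≤ c * n ^ suc n
  decreasing c d n₀ base n₀≤n = go (≤⇒≤′ n₀≤n)
    where
      go : ∀ {n} → n₀ ≤′ n → d * suc n ^ suc n ≤ c * n ^ suc n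
      go (≤′-reflexive refl) = base
      go (≤′-step {n} h)     = decreasing-step c d n {{>-nonZero (≤-trans (>-nonZero⁻¹ n₀) (≤′⇒≤ h))}} (go h)

  -- (1 + 1/n)^p ≤ (1 + 1/n)^(n+1), and the latter decreases in n, with value (6/5)^6 < 3 at n = 5.
  -- The exponent r pads p up to n + 1.
  [1+n]^p≤3n^p : ∀ {n p} → 5 ≤ n → p ≤ suc n → suc n ^ p ≤ 3 * n ^ p
  [1+n]^p≤3n^p {n} {p} 5≤n p≤1+n with m≤n⇒∃[o]m+o≡n p≤1+n
  ... | r , p+r≡1+n = *-cancelˡ-≤ (n ^ r) {{m^n≢0 n r {{>-nonZero (≤-trans (s≤s z≤n) 5≤n)}}}} (begin
    n ^ r * suc n ^ p      ≤⟨ *-monoˡ-≤ (suc n ^ p) (^-monoˡ-≤ r (n≤1+n n)) ⟩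
    suc n ^ r * suc n ^ p  ≡⟨ *-comm (suc n ^ r) (suc n ^ p) ⟩
    suc n ^ p * suc n ^ r  ≡⟨ ^-distribˡ-+-* (suc n) p r ⟨
    suc n ^ (p + r)        ≡⟨ cong (suc n ^_) p+r≡1+n ⟩
    suc n ^ suc n          ≡⟨ *-identityˡ _ ⟨
    1 * suc n ^ suc n      ≤⟨ decreasing 3 1 5 (toWitness {a? = 1 * 6 ^ 6 ≤? 3 * 5 ^ 6} tt) 5≤n ⟩
    3 * n ^ suc n          ≡⟨ cong (λ t → 3 * n ^ t) p+r≡1+n ⟨
    3 * n ^ (p + r)        ≡⟨ cong (3 *_) (^-distribˡ-+-* n p r) ⟩
    3 * (n ^ p * n ^ r)    ≡⟨ eq (n ^ p) (n ^ r) ⟩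
    n ^ r * (3 * n ^ p)    ∎)
    where
      eq : ∀ x y → 3 * (x * y) ≡ y * (3 * x)
      eq = solve-∀

  nC0≡1 : ∀ n → n choose 0 ≡ 1
  nC0≡1 n = trans (nCk≡nC[n∸k] {0} {n} z≤n) (nCn≡1 n)

  -- The identity (k + 1) C(n,k+1) = (n - k) C(n,k) with the subtracted term moved to the left, so
  -- that it can be stated and proved by Pascal's rule without truncated subtraction.
  absorption : ∀ n k → suc k * (n choose suc k) + k * (n choose k) ≡ n * (n choose k)
  absorption zero    zero    = refl
  absorption zero    (suc k) = eq k
    where
      eq : ∀ k → suc (suc k) * 0 + suc k * 0 ≡ 0
      eq = solve-∀
  absorption (suc n) zero    = trans (cong₂ (λ x y → 1 * x + 0 * y) (nC1≡n (suc n)) (nC0≡1 (suc n)))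
    (trans (eq (suc n)) (cong (suc n *_) (sym (nC0≡1 (suc n)))))
    where
      eq : ∀ n → 1 * n + 0 * 1 ≡ n * 1
      eq = solve-∀
  absorption (suc n) (suc k) = begin-equality
    (2 + k) * (suc n choose (2 + k)) + suc k * (suc n choose suc k)
      ≡⟨ cong₂ (λ s t → (2 + k) * s + suc k * t) (nCk+nC[k+1]≡[n+1]C[k+1] n (suc k)) (nCk+nC[k+1]≡[n+1]C[k+1] n k) ⟨
    (2 + k) * (y + z) + suc k * (x + y)
      ≡⟨ eq₁ k x y z ⟩
    ((2 + k) * z + suc k * y) + (suc k * y + k * x) + (x + y)
      ≡⟨ cong₂ (λ s t → s + t + (x + y)) (absorption n (suc k)) (absorption n k) ⟩
    n * y + n * x + (x + y)
      ≡⟨ eq₂ n x y ⟩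
    suc n * (x + y)
      ≡⟨ cong (suc n *_) (nCk+nC[k+1]≡[n+1]C[k+1] n k) ⟩
    suc n * (suc n choose suc k) ∎
    where
      x = n choose k
      y = n choose suc k
      z = n choose (2 + k)
      eq₁ : ∀ k x y z → (2 + k) * (y + z) + suc k * (x + y) ≡ ((2 + k) * z + suc k * y) + (suc k * y + k * x) + (x + y)
      eq₁ = solve-∀
      eq₂ : ∀ n x y → n * y + n * x + (x + y) ≡ suc n * (x + y)
      eq₂ = solve-∀

  -- (1 + e)^p ≤ C(p,k) (2e)^k for e = k / p, cleared of denominators.
  BinomialBound : ℕ → ℕ → Set
  BinomialBound p k = (p + k) ^ p * p ^ k ≤ (p choose k) * (2 * k) ^ k * p ^ p

  -- Since (p+2)/p = (p+2)/(p+1) · (p+1)/p, two uses of the decreasing sequence (1 + 1/n)^(n+1), at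
  -- n = p + 1 and n = p, bound (1 + 2/p)^p and leave the polynomial inequality `poly`. The factor
  -- (2 + p)² raises the exponent p to p + 2.
  binomialBound-large₂ : ∀ {p} → 13 ≤ p → BinomialBound p 2
  binomialBound-large₂ {p} 13≤p = *-cancelˡ-≤ (17 * 17 * ((2 + p) * (2 + p))) (begin
    17 * 17 * ((2 + p) * (2 + p)) * ((p + 2) ^ p * p ^ 2)
      ≡⟨ cong (λ t → 17 * 17 * ((2 + p) * (2 + p)) * (t ^ p * p ^ 2)) (+-comm p 2) ⟩
    17 * 17 * ((2 + p) * (2 + p)) * (R * p ^ 2)  ≡⟨ eq₁ p R ⟩
    p * p * (17 * 17 * ((2 + p) ^ (2 + p)))      ≤⟨ *-monoʳ-≤ (p * p) two-steps ⟩
    p * p * (48 * 48 * suc p * p ^ suc p)        ≡⟨ eq₂ p (p ^ p) ⟩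
    p * (48 * 48) * (p * p * suc p) * p ^ p      ≤⟨ *-monoˡ-≤ (p ^ p) (poly p (≤-trans (toWitness {a? = 2 ≤? 13} tt) 13≤p)) ⟩
    17 * 17 * ((2 + p) * (2 + p)) * (16 * X) * p ^ p
      ≡⟨ eq₃ (17 * 17 * ((2 + p) * (2 + p))) X (p ^ p) ⟩
    17 * 17 * ((2 + p) * (2 + p)) * (X * (2 * 2) ^ 2 * p ^ p) ∎)
    where
      R = (2 + p) ^ p
      X = p choose 2
      -- (14/13)^14 ≤ 48/17, and (48/17)² ≤ 8 bounds the limit e² of (1 + 2/p)^p well enough.
      decr : ∀ {n} → 13 ≤ n → 17 * suc n ^ suc n ≤ 48 * n ^ suc n
      decr = decreasing 48 17 13 (toWitness {a? = 17 * 14 ^ 14 ≤? 48 * 13 ^ 14} tt)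
      eq₁ : ∀ p R → 17 * 17 * ((2 + p) * (2 + p)) * (R * (p * (p * 1))) ≡ p * p * (17 * 17 * ((2 + p) * ((2 + p) * R)))
      eq₁ = solve-∀
      eq₂ : ∀ p x → p * p * (48 * 48 * suc p * (p * x)) ≡ p * (48 * 48) * (p * p * suc p) * x
      eq₂ = solve-∀
      eq₃ : ∀ u X x → u * (16 * X) * x ≡ u * (X * 16 * x)
      eq₃ = solve-∀
      two-steps : 17 * 17 * ((2 + p) ^ (2 + p)) ≤ 48 * 48 * suc p * p ^ suc p
      two-steps = begin
        17 * 17 * ((2 + p) ^ (2 + p))        ≡⟨ *-assoc 17 17 ((2 + p) ^ (2 + p)) ⟩
        17 * (17 * ((2 + p) ^ (2 + p)))      ≤⟨ *-monoʳ-≤ 17 (decr (m≤n⇒m≤1+n 13≤p)) ⟩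
        17 * (48 * (suc p * suc p ^ suc p))  ≡⟨ eq (suc p) (suc p ^ suc p) ⟩
        48 * suc p * (17 * suc p ^ suc p)    ≤⟨ *-monoʳ-≤ (48 * suc p) (decr 13≤p) ⟩
        48 * suc p * (48 * p ^ suc p)        ≡⟨ eq′ (suc p) (p ^ suc p) ⟩
        48 * 48 * suc p * p ^ suc p          ∎
        where
          eq : ∀ x y → 17 * (48 * (x * y)) ≡ 48 * x * (17 * y)
          eq = solve-∀
          eq′ : ∀ x y → 48 * x * (48 * y) ≡ 48 * 48 * x * y
          eq′ = solve-∀
      2C : ∀ p → 2 * (suc p choose 2) ≡ suc p * p
      2C p = +-cancelʳ-≡ (suc p) (2 * (suc p choose 2)) (suc p * p) (begin-equality
        2 * (suc p choose 2) + suc p                 ≡⟨ cong (λ t → 2 * (suc p choose 2) + t) (trans (*-identityˡ _) (nC1≡n (suc p))) ⟨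
        2 * (suc p choose 2) + 1 * (suc p choose 1)  ≡⟨ absorption (suc p) 1 ⟩
        suc p * (suc p choose 1)                     ≡⟨ cong (suc p *_) (nC1≡n (suc p)) ⟩
        suc p * suc p                                ≡⟨ eq p ⟩
        suc p * p + suc p                            ∎)
        where
          eq : ∀ p → suc p * suc p ≡ suc p * p + suc p
          eq = solve-∀
      poly : ∀ p → 2 ≤ p → p * (48 * 48) * (p * p * suc p) ≤ 17 * 17 * ((2 + p) * (2 + p)) * (16 * (p choose 2))
      poly (suc zero) (s≤s ())
      -- In terms of q = p - 2 the difference of the two sides is a polynomial with nonnegative
      -- coefficients.
      poly (suc (suc q)) _ = begin
        p′ * (48 * 48) * (p′ * p′ * suc p′) ≤⟨ m≤m+n _ _ ⟩
        p′ * (48 * 48) * (p′ * p′ * suc p′) + p′ * (8 * (p′ * p′ * suc p′) + 17 * 17 * 8 * (2 * q * q + 8 * q + 4)) ≡⟨ eq q ⟩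
        17 * 17 * 8 * ((2 + p′) * (2 + p′)) * (p′ * suc q) ≡⟨ cong (17 * 17 * 8 * ((2 + p′) * (2 + p′)) *_) (2C (suc q)) ⟨
        17 * 17 * 8 * ((2 + p′) * (2 + p′)) * (2 * (p′ choose 2)) ≡⟨ eq′ ((2 + p′) * (2 + p′)) (p′ choose 2) ⟩
        17 * 17 * ((2 + p′) * (2 + p′)) * (16 * (p′ choose 2)) ∎
        where
          p′ = 2 + q
          eq : ∀ q → (2 + q) * (48 * 48) * ((2 + q) * (2 + q) * (3 + q)) + (2 + q) * (8 * ((2 + q) * (2 + q) * (3 + q)) + 17 * 17 * 8 * (2 * q * q + 8 * q + 4))
            ≡ 17 * 17 * 8 * ((4 + q) * (4 + q)) * ((2 + q) * suc q)
          eq = solve-∀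
          eq′ : ∀ u x → 17 * 17 * 8 * u * (2 * x) ≡ 17 * 17 * u * (16 * x)
          eq′ = solve-∀

  -- Base case of the induction on k. The estimate (1 + 1/n)^(n+1) ≤ 48/17 starts at n = 13, so 8 ≤
  -- p ≤ 12 is settled by computation.
  binomialBound₂ : ∀ {p} → 8 ≤ p → BinomialBound p 2
  binomialBound₂ {p} 8≤p with m≤n⇒∃[o]m+o≡n 8≤p
  ... | 0 , refl = toWitness {a? = (8 + 2) ^ 8 * 8 ^ 2 ≤? (8 choose 2) * (2 * 2) ^ 2 * 8 ^ 8} tt
  ... | 1 , refl = toWitness {a? = (9 + 2) ^ 9 * 9 ^ 2 ≤? (9 choose 2) * (2 * 2) ^ 2 * 9 ^ 9} tt
  ... | 2 , refl = toWitness {a? = (10 + 2) ^ 10 * 10 ^ 2 ≤? (10 choose 2) * (2 * 2) ^ 2 * 10 ^ 10} tt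
  ... | 3 , refl = toWitness {a? = (11 + 2) ^ 11 * 11 ^ 2 ≤? (11 choose 2) * (2 * 2) ^ 2 * 11 ^ 11} tt
  ... | 4 , refl = toWitness {a? = (12 + 2) ^ 12 * 12 ^ 2 ≤? (12 choose 2) * (2 * 2) ^ 2 * 12 ^ 12} tt
  ... | suc (suc (suc (suc (suc o)))) , refl = binomialBound-large₂ (m≤m+n 13 o)

  -- From k to k + 1 the left side grows by at most 3p, as (1 + 1/(p+k))^p ≤ 3. On the right, C(p,k)
  -- gains (p - k)/(k + 1) ≥ (3/4) p/(k + 1) because p ≥ 4k, and (2k)^k gains 2(k + 1)(1 + 1/k)^k ≥
  -- 4(k + 1), which together make at least 3p.
  binomialBound-step : ∀ {p k} .{{_ : NonZero k}} → 4 * suc k ≤ p → BinomialBound p k → BinomialBound p (suc k)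
  binomialBound-step {p} {k} 4[1+k]≤p hyp = begin
    (p + suc k) ^ p * (p * p ^ k)                  ≡⟨ cong (λ t → t ^ p * (p * p ^ k)) (+-suc p k) ⟩
    suc (p + k) ^ p * (p * p ^ k)                  ≤⟨ *-monoˡ-≤ (p * p ^ k) ([1+n]^p≤3n^p 5≤p+k (m≤n⇒m≤1+n (m≤m+n p k))) ⟩
    3 * (p + k) ^ p * (p * p ^ k)                  ≡⟨ eq₁ p ((p + k) ^ p) (p ^ k) ⟩
    3 * p * ((p + k) ^ p * p ^ k)                  ≤⟨ *-monoʳ-≤ (3 * p) hyp ⟩
    3 * p * (X * (2 * k) ^ k * p ^ p)              ≡⟨ eq₂ p X ((2 * k) ^ k) (p ^ p) ⟩
    3 * p * X * ((2 * k) ^ k * p ^ p)              ≤⟨ *-monoˡ-≤ ((2 * k) ^ k * p ^ p) next ⟩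
    4 * (suc k * Y) * ((2 * k) ^ k * p ^ p)        ≡⟨ cong (λ t → 4 * (suc k * Y) * (t * p ^ p)) (^-distribʳ-* k 2 k) ⟩
    4 * (suc k * Y) * (2 ^ k * k ^ k * p ^ p)      ≡⟨ eq₃ (suc k) Y (2 ^ k) (k ^ k) (p ^ p) ⟩
    2 * suc k * Y * 2 ^ k * p ^ p * (2 * k ^ k)    ≤⟨ *-monoʳ-≤ (2 * suc k * Y * 2 ^ k * p ^ p) (2n^n≤[1+n]^n k) ⟩
    2 * suc k * Y * 2 ^ k * p ^ p * suc k ^ k      ≡⟨ eq₄ (suc k) Y (2 ^ k) (p ^ p) (suc k ^ k) ⟩
    Y * (2 * suc k * (2 ^ k * suc k ^ k)) * p ^ p  ≡⟨ cong (λ t → Y * (2 * suc k * t) * p ^ p) (^-distribʳ-* k 2 (suc k)) ⟨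
    Y * (2 * suc k * (2 * suc k) ^ k) * p ^ p      ∎
    where
      X = p choose k
      Y = p choose suc k
      5≤p+k : 5 ≤ p + k
      5≤p+k = +-mono-≤ (≤-trans (*-monoʳ-≤ 4 (s≤s z≤n)) 4[1+k]≤p) (>-nonZero⁻¹ k)
      eq₁ : ∀ p x y → 3 * x * (p * y) ≡ 3 * p * (x * y)
      eq₁ = solve-∀
      eq₂ : ∀ p x y z → 3 * p * (x * y * z) ≡ 3 * p * x * (y * z)
      eq₂ = solve-∀
      eq₃ : ∀ s y a b c → 4 * (s * y) * (a * b * c) ≡ 2 * s * y * a * c * (2 * b)
      eq₃ = solve-∀
      eq₄ : ∀ s y a c d → 2 * s * y * a * c * d ≡ y * (2 * s * (a * d)) * c
      eq₄ = solve-∀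
      next : 3 * p * X ≤ 4 * (suc k * Y)
      next = +-cancelʳ-≤ (p * X) _ _ (begin
        3 * p * X + p * X            ≡⟨ eq₅ p X ⟩
        4 * (p * X)                  ≡⟨ cong (4 *_) (absorption p k) ⟨
        4 * (suc k * Y + k * X)      ≡⟨ eq₆ (suc k * Y) k X ⟩
        4 * (suc k * Y) + 4 * k * X  ≤⟨ +-monoʳ-≤ (4 * (suc k * Y)) (*-monoˡ-≤ X (≤-trans (*-monoʳ-≤ 4 (n≤1+n k)) 4[1+k]≤p)) ⟩
        4 * (suc k * Y) + p * X      ∎)
        where
          eq₅ : ∀ p x → 3 * p * x + p * x ≡ 4 * (p * x)
          eq₅ = solve-∀
          eq₆ : ∀ u k x → 4 * (u + k * x) ≡ 4 * u + 4 * k * x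
          eq₆ = solve-∀

  binomialBound : ∀ {p k} → 2 ≤ k → 4 * k ≤ p → BinomialBound p k
  binomialBound {p} 2≤k = go (≤⇒≤′ 2≤k)
    where
      go : ∀ {k} → 2 ≤′ k → 4 * k ≤ p → BinomialBound p k
      go (≤′-reflexive refl) 8≤p = binomialBound₂ 8≤p
      go (≤′-step {k} 2≤′k)  h   =
        binomialBound-step {{>-nonZero (≤-trans (s≤s z≤n) (≤′⇒≤ 2≤′k))}} h
          (go 2≤′k (≤-trans (*-monoʳ-≤ 4 (n≤1+n k)) h))

  -- Permits division by C(p,k): were it 0, the right side of the bound would vanish while the left
  -- side is positive.
  binomialBound⇒nonZero : ∀ {p k} .{{_ : NonZero p}} → BinomialBound p k → NonZero (p choose k)
  binomialBound⇒nonZero {p} {k} bound with p choose k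
  ... | suc _ = _
  ... | zero  = contradiction bound
    (<⇒≱ (m*n>0 (m^n>0 (p + k) {{>-nonZero (≤-trans (>-nonZero⁻¹ p) (m≤m+n p k))}} p) (m^n>0 p k)))
    where
      m*n>0 : ∀ {m n} → 0 < m → 0 < n → 0 < m * n
      m*n>0 = *-mono-≤

open BinomialInequality using (nC0≡1; BinomialBound; binomialBound; binomialBound⇒nonZero)

open import Level using (Level)
open import Algebra.Bundles using (AbelianGroup; CommutativeRing; RawGroup)
open import Algebra.Core using (Op₁; Op₂)
import Algebra.Morphism.GroupMonomorphism as GroupMonomorphism
open import Algebra.Structures using (IsAbelianGroup)
open import Data.Bool.Base using (true; false; if_then_else_)
open import Data.Fin.Base as Fin using (Fin)
open import Data.Fin.Permutation using (Permutation′; permutation; _⟨$⟩ʳ_)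
open import Data.Fin.Subset using (Subset; Nonempty; ∣_∣; inside; outside)
import Data.Integer.Base as ℤ
import Data.Integer.Properties as ℤ
open import Data.Rational.Base as ℚ
  using (ℚ; 0ℚ; 1ℚ; ½; _/_; _+_; _*_; _-_; -_; _⊔_; _≤_; _<_; toℚᵘ; nonNegative; positive; nonPositive)
open import Data.Rational.Properties
open import Data.Rational.Solver using (module +-*-Solver)
import Data.Rational.Unnormalised.Base as ℚᵘ
import Data.Rational.Unnormalised.Properties as ℚᵘ
open import Data.Sum.Base using (inj₁; inj₂)
open import Data.Vec.Base using (Vec; []; _∷_; lookup; map; there)
open import Data.Vec.Functional using (foldr)
open import Function.Base using (_∘_)
open import Function.Bundles using (Inverse)
open import Defs

open +-*-Solver using (solve; _:=_; _:+_; _:*_; _:-_; con; :-_)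
private module ℚ-ring = CommutativeRing +-*-commutativeRing
open import Algebra.Properties.CommutativeMonoid.Sum ℚ-ring.+-commutativeMonoid
  using (sum-cong-≗; ∑-distrib-+; ∑-comm; sum-permute)
open import Algebra.Properties.CommutativeSemiring.Exp ℚ-ring.commutativeSemiring
  using (^-distrib-*; ^-assocʳ)
open import Algebra.Properties.Semiring.Sum ℚ-ring.semiring using (*-distribˡ-sum)

-- Rational arithmetic, powers and their tangents.

fromℕ-+ : ∀ m n → fromℕ (m ℕ.+ n) ≡ fromℕ m + fromℕ n
fromℕ-+ m n = toℚᵘ-injective (begin
  toℚᵘ (fromℕ (m ℕ.+ n))                    ≈⟨ toℚᵘ-fromℚᵘ (ℚᵘ.mkℚᵘ (ℤ.+ (m ℕ.+ n)) 0) ⟩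
  ℚᵘ.mkℚᵘ (ℤ.+ (m ℕ.+ n)) 0                 ≡⟨ cong (λ z → ℚᵘ.mkℚᵘ z 0) (cong₂ ℤ._+_ (ℤ.*-identityʳ (ℤ.+ m)) (ℤ.*-identityʳ (ℤ.+ n))) ⟨
  ℚᵘ.mkℚᵘ (ℤ.+ m) 0 ℚᵘ.+ ℚᵘ.mkℚᵘ (ℤ.+ n) 0  ≈⟨ ℚᵘ.+-cong (toℚᵘ-fromℚᵘ (ℚᵘ.mkℚᵘ (ℤ.+ m) 0)) (toℚᵘ-fromℚᵘ (ℚᵘ.mkℚᵘ (ℤ.+ n) 0)) ⟨
  toℚᵘ (fromℕ m) ℚᵘ.+ toℚᵘ (fromℕ n)        ≈⟨ toℚᵘ-homo-+ (fromℕ m) (fromℕ n) ⟨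
  toℚᵘ (fromℕ m + fromℕ n)                  ∎)
  where open ℚᵘ.≃-Reasoning

m/n*n≡m : ∀ m n .{{_ : NonZero n}} → (ℤ.+ m / n) * fromℕ n ≡ fromℕ m
m/n*n≡m m n@(suc n-1) = toℚᵘ-injective (begin
  toℚᵘ ((ℤ.+ m / n) * fromℕ n)                ≈⟨ toℚᵘ-homo-* (ℤ.+ m / n) (fromℕ n) ⟩
  toℚᵘ (ℤ.+ m / n) ℚᵘ.* toℚᵘ (fromℕ n)        ≈⟨ ℚᵘ.*-cong (toℚᵘ-fromℚᵘ (ℚᵘ.mkℚᵘ (ℤ.+ m) n-1)) (toℚᵘ-fromℚᵘ (ℚᵘ.mkℚᵘ (ℤ.+ n) 0)) ⟩
  ℚᵘ.mkℚᵘ (ℤ.+ m) n-1 ℚᵘ.* ℚᵘ.mkℚᵘ (ℤ.+ n) 0  ≈⟨ ℚᵘ.*≡* (ℤ.*-assoc (ℤ.+ m) (ℤ.+ n) (ℤ.+ 1)) ⟩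
  ℚᵘ.mkℚᵘ (ℤ.+ m) 0                           ≈⟨ toℚᵘ-fromℚᵘ (ℚᵘ.mkℚᵘ (ℤ.+ m) 0) ⟨
  toℚᵘ (fromℕ m)                              ∎)
  where open ℚᵘ.≃-Reasoning

open ≤-Reasoning

fromℕ-suc : ∀ n → fromℕ (suc n) ≡ 1ℚ + fromℕ n
fromℕ-suc = fromℕ-+ 1

fromℕ-* : ∀ m n → fromℕ (m ℕ.* n) ≡ fromℕ m * fromℕ n
fromℕ-* zero    n = sym (*-zeroˡ (fromℕ n))
fromℕ-* (suc m) n = begin-equality
  fromℕ (n ℕ.+ m ℕ.* n)        ≡⟨ fromℕ-+ n (m ℕ.* n) ⟩
  fromℕ n + fromℕ (m ℕ.* n)    ≡⟨ cong (fromℕ n +_) (fromℕ-* m n) ⟩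
  fromℕ n + fromℕ m * fromℕ n  ≡⟨ solve 2 (λ m n → n :+ m :* n := (con 1ℚ :+ m) :* n) refl (fromℕ m) (fromℕ n) ⟩
  (1ℚ + fromℕ m) * fromℕ n     ≡⟨ cong (_* fromℕ n) (fromℕ-suc m) ⟨
  fromℕ (suc m) * fromℕ n      ∎

fromℕ-^ : ∀ m n → fromℕ (m ℕ.^ n) ≡ fromℕ m ^ n
fromℕ-^ m zero    = refl
fromℕ-^ m (suc n) = trans (fromℕ-* m (m ℕ.^ n)) (cong (fromℕ m *_) (fromℕ-^ m n))

0≤1 : 0ℚ ≤ 1ℚ
0≤1 = toWitness {a? = 0ℚ ≤? 1ℚ} tt

fromℕ-nonNeg : ∀ n → 0ℚ ≤ fromℕ n
fromℕ-nonNeg n = nonNegative⁻¹ _ {{normalize-nonNeg n 1}}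

fromℕ-pos : ∀ n .{{_ : NonZero n}} → 0ℚ < fromℕ n
fromℕ-pos n = positive⁻¹ _ {{normalize-pos n 1}}

p≤p+q : ∀ {p q} → 0ℚ ≤ q → p ≤ p + q
p≤p+q {p} {q} 0≤q = begin
  p       ≡⟨ +-identityʳ p ⟨
  p + 0ℚ  ≤⟨ +-monoʳ-≤ p 0≤q ⟩
  p + q   ∎

fromℕ-mono-≤ : ∀ {m n} → m ℕ.≤ n → fromℕ m ≤ fromℕ n
fromℕ-mono-≤ {m} {n} m≤n with ℕ.m≤n⇒∃[o]m+o≡n m≤n
... | o , refl = subst (fromℕ m ≤_) (sym (fromℕ-+ m o)) (p≤p+q (fromℕ-nonNeg o))

0≤q-p : ∀ {p q} → p ≤ q → 0ℚ ≤ q - p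
0≤q-p {p} {q} p≤q = begin
  0ℚ     ≡⟨ +-inverseʳ p ⟨
  p - p  ≤⟨ +-monoˡ-≤ (- p) p≤q ⟩
  q - p  ∎

*-monoˡ : ∀ {r p q} → 0ℚ ≤ r → p ≤ q → r * p ≤ r * q
*-monoˡ {r} 0≤r = *-monoˡ-≤-nonNeg r {{nonNegative 0≤r}}

*-monoʳ : ∀ {r p q} → 0ℚ ≤ r → p ≤ q → p * r ≤ q * r
*-monoʳ {r} 0≤r = *-monoʳ-≤-nonNeg r {{nonNegative 0≤r}}

0≤p*q : ∀ {p q} → 0ℚ ≤ p → 0ℚ ≤ q → 0ℚ ≤ p * q
0≤p*q {p} {q} 0≤p 0≤q = subst (_≤ p * q) (*-zeroʳ p) (*-monoˡ 0≤p 0≤q)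

0<p*q : ∀ {p q} → 0ℚ < p → 0ℚ < q → 0ℚ < p * q
0<p*q {p} {q} 0<p 0<q = subst (_< p * q) (*-zeroʳ p) (*-monoʳ-<-pos p {{positive 0<p}} 0<q)

*-cancelˡ : ∀ {r p q} → 0ℚ < r → r * p ≤ r * q → p ≤ q
*-cancelˡ {r} 0<r = *-cancelˡ-≤-pos r {{positive 0<r}}

0≤p*p : ∀ p → 0ℚ ≤ p * p
0≤p*p p with ≤-total 0ℚ p
... | inj₁ 0≤p = 0≤p*q 0≤p 0≤p
... | inj₂ p≤0 = subst (_≤ p * p) (*-zeroʳ p) (*-monoˡ-≤-nonPos p {{nonPositive p≤0}} p≤0)

^-nonNeg : ∀ {q} n → 0ℚ ≤ q → 0ℚ ≤ q ^ n
^-nonNeg zero    0≤q = 0≤1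
^-nonNeg (suc n) 0≤q = 0≤p*q 0≤q (^-nonNeg n 0≤q)

^-pos : ∀ {q} n → 0ℚ < q → 0ℚ < q ^ n
^-pos zero    0<q = toWitness {a? = 0ℚ <? 1ℚ} tt
^-pos (suc n) 0<q = 0<p*q 0<q (^-pos n 0<q)

^-mono-≤ : ∀ {p q} n → 0ℚ ≤ p → p ≤ q → p ^ n ≤ q ^ n
^-mono-≤ zero    0≤p p≤q = ≤-refl
^-mono-≤ {p} {q} (suc n) 0≤p p≤q = begin
  p * p ^ n  ≤⟨ *-monoˡ 0≤p (^-mono-≤ n 0≤p p≤q) ⟩
  p * q ^ n  ≤⟨ *-monoʳ (^-nonNeg n (≤-trans 0≤p p≤q)) p≤q ⟩
  q * q ^ n  ∎

1^n≡1 : ∀ n → 1ℚ ^ n ≡ 1ℚ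
1^n≡1 zero    = refl
1^n≡1 (suc n) = trans (*-identityˡ (1ℚ ^ n)) (1^n≡1 n)

^-mono-< : ∀ {p q} n .{{_ : NonZero n}} → 0ℚ ≤ p → p < q → p ^ n < q ^ n
^-mono-< {p} {q} (suc n) 0≤p p<q = begin-strict
  p * p ^ n  ≤⟨ *-monoˡ 0≤p (^-mono-≤ n 0≤p (<⇒≤ p<q)) ⟩
  p * q ^ n  <⟨ *-monoˡ-<-pos (q ^ n) {{positive (^-pos n (≤-<-trans 0≤p p<q))}} p<q ⟩
  q * q ^ n  ∎

^-cancel-≤ : ∀ {p q} n .{{_ : NonZero n}} → 0ℚ ≤ q → p ^ n ≤ q ^ n → p ≤ q
^-cancel-≤ n 0≤q p^n≤q^n = ≮⇒≥ λ q<p → <-irrefl refl (<-≤-trans (^-mono-< n 0≤q q<p) p^n≤q^n)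

p≤∣p∣ : ∀ p → p ≤ ℚ.∣ p ∣
p≤∣p∣ p with ≤-total 0ℚ p
... | inj₁ 0≤p = ≤-reflexive (sym (0≤p⇒∣p∣≡p 0≤p))
... | inj₂ p≤0 = ≤-trans p≤0 (0≤∣p∣ p)

∣p^n∣≡∣p∣^n : ∀ p n → ℚ.∣ p ^ n ∣ ≡ ℚ.∣ p ∣ ^ n
∣p^n∣≡∣p∣^n p zero    = refl
∣p^n∣≡∣p∣^n p (suc n) = trans (∣p*q∣≡∣p∣*∣q∣ p (p ^ n)) (cong (ℚ.∣ p ∣ *_) (∣p^n∣≡∣p∣^n p n))

p^n≤∣p∣^n : ∀ p n → p ^ n ≤ ℚ.∣ p ∣ ^ n
p^n≤∣p∣^n p n = ≤-trans (p≤∣p∣ (p ^ n)) (≤-reflexive (∣p^n∣≡∣p∣^n p n))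

∣p∣^n≡p^n : ∀ p {n} → 2 ∣ n → ℚ.∣ p ∣ ^ n ≡ p ^ n
∣p∣^n≡p^n p (divides m refl) = begin-equality
  ℚ.∣ p ∣ ^ (m ℕ.* 2)  ≡⟨ ∣p^n∣≡∣p∣^n p (m ℕ.* 2) ⟨
  ℚ.∣ p ^ (m ℕ.* 2) ∣  ≡⟨ cong ℚ.∣_∣ square ⟩
  ℚ.∣ p ^ m * p ^ m ∣  ≡⟨ 0≤p⇒∣p∣≡p (0≤p*p (p ^ m)) ⟩
  p ^ m * p ^ m        ≡⟨ square ⟨
  p ^ (m ℕ.* 2)        ∎
  where
    square : p ^ (m ℕ.* 2) ≡ p ^ m * p ^ m
    square = trans (sym (^-assocʳ p m 2)) (cong (p ^ m *_) (*-identityʳ (p ^ m)))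

-- Convexity: the left side is the tangent of y^(m+1) at a. In the induction, y times the tangent
-- for exponent m + 1 exceeds the tangent for m + 2 by a^m (m + 1) (y - a)² ≥ 0.
tangent≤^ : ∀ {a y} m → 0ℚ ≤ a → 0ℚ ≤ y →
  a ^ m * (a + fromℕ (suc m) * (y - a)) ≤ y ^ suc m
tangent≤^ {a} {y} zero    0≤a 0≤y = ≤-reflexive
  (solve 2 (λ a y → con 1ℚ :* (a :+ con 1ℚ :* (y :- a)) := y :* con 1ℚ) refl a y)
tangent≤^ {a} {y} (suc m) 0≤a 0≤y = begin
  a * a ^ m * (a + fromℕ (2 ℕ.+ m) * (y - a))
    ≡⟨ cong (λ t → a * a ^ m * (a + t * (y - a))) (fromℕ-suc (suc m)) ⟩
  a * a ^ m * (a + (1ℚ + s) * (y - a))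
    ≤⟨ p≤p+q (0≤p*q (0≤p*q (^-nonNeg m 0≤a) (fromℕ-nonNeg (suc m))) (0≤p*p (y - a))) ⟩
  a * a ^ m * (a + (1ℚ + s) * (y - a)) + a ^ m * s * ((y - a) * (y - a))
    ≡⟨ solve 4 (λ a y x s → a :* x :* (a :+ (con 1ℚ :+ s) :* (y :- a)) :+ x :* s :* ((y :- a) :* (y :- a))
         := y :* (x :* (a :+ s :* (y :- a)))) refl a y (a ^ m) s ⟩
  y * (a ^ m * (a + s * (y - a)))
    ≤⟨ *-monoˡ 0≤y (tangent≤^ m 0≤a 0≤y) ⟩
  y * y ^ suc m ∎
  where s = fromℕ (suc m)

-- In terms of k + 1 and p + 1 in place of k and p, and cleared of denominators: (1 + e)^p / e^k
-- is at most its value at e = k/p. Both powers that depend on e are compared with their tangents.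
ratio-bound : ∀ {e} k p → fromℕ (suc k) ≤ fromℕ (suc p) * e → fromℕ p * e ≤ fromℕ (suc k) → 0ℚ ≤ e →
  (fromℕ (suc p) * (1ℚ + e)) ^ suc p * fromℕ (suc k) ^ suc k
    ≤ (fromℕ (suc p) * e) ^ suc k * (fromℕ (suc p) + fromℕ (suc k)) ^ suc p
ratio-bound {e} k p K≤Pe pe≤K 0≤e = begin
  (P * (1ℚ + e)) ^ suc p * K ^ suc k
    -- The tangent of y^(k+1) at K, taken at P e, times the tangent of y^(p+1) at X, taken at P + K,
    -- exceeds the left side by exactly this term. It is nonnegative since K ≤ P e and p e ≤ K.
    ≤⟨ p≤p+q (0≤p*q (0≤p*q (^-nonNeg p 0≤X) (^-nonNeg (suc k) 0≤K))
         (0≤p*q (0≤p*q 0≤d 0≤P) (0≤q-p pe≤K))) ⟩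
  X ^ suc p * K ^ suc k + X ^ p * K ^ suc k * (d * P * (K - fromℕ p * e))
    ≡⟨ cong (λ t → (t * (1ℚ + e)) * (t * (1ℚ + e)) ^ p * K ^ suc k
         + (t * (1ℚ + e)) ^ p * K ^ suc k * ((t * e - K) * t * (K - fromℕ p * e))) (fromℕ-suc p) ⟩
  _ ≡⟨ solve 5 (λ p e K x y →
         (con 1ℚ :+ p) :* (con 1ℚ :+ e) :* x :* (K :* y)
           :+ x :* (K :* y) :* (((con 1ℚ :+ p) :* e :- K) :* (con 1ℚ :+ p) :* (K :- p :* e))
         := (y :* (K :+ K :* ((con 1ℚ :+ p) :* e :- K)))
           :* (x :* ((con 1ℚ :+ p) :* (con 1ℚ :+ e) :+ (con 1ℚ :+ p) :* (((con 1ℚ :+ p) :+ K) :- (con 1ℚ :+ p) :* (con 1ℚ :+ e)))))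
         refl (fromℕ p) e K (((1ℚ + fromℕ p) * (1ℚ + e)) ^ p) (K ^ k) ⟩
  _ ≡⟨ cong (λ t → (K ^ k * (K + K * (t * e - K)))
         * ((t * (1ℚ + e)) ^ p * (t * (1ℚ + e) + t * ((t + K) - t * (1ℚ + e))))) (fromℕ-suc p) ⟨
  (K ^ k * (K + K * (P * e - K))) * (X ^ p * (X + P * ((P + K) - X)))
    ≤⟨ *-monoˡ (0≤p*q (^-nonNeg k 0≤K) (+-mono-≤ 0≤K (0≤p*q 0≤K 0≤d))) (tangent≤^ p 0≤X 0≤Y) ⟩
  (K ^ k * (K + K * (P * e - K))) * (P + K) ^ suc p
    ≤⟨ *-monoʳ (^-nonNeg (suc p) 0≤Y) (tangent≤^ k 0≤K (0≤p*q 0≤P 0≤e)) ⟩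
  (P * e) ^ suc k * (P + K) ^ suc p ∎
  where
    P = fromℕ (suc p)
    K = fromℕ (suc k)
    X = P * (1ℚ + e)
    d = P * e - K
    0≤P : 0ℚ ≤ P
    0≤P = fromℕ-nonNeg (suc p)
    0≤K : 0ℚ ≤ K
    0≤K = fromℕ-nonNeg (suc k)
    0≤X : 0ℚ ≤ X
    0≤X = 0≤p*q 0≤P (+-mono-≤ 0≤1 0≤e)
    0≤Y : 0ℚ ≤ P + K
    0≤Y = +-mono-≤ 0≤P 0≤K
    0≤d : 0ℚ ≤ d
    0≤d = 0≤q-p K≤Pe

2ℚ : ℚ
2ℚ = fromℕ 2

-- `ratio-bound` reduces the claim to e = k/p, where it is `BinomialBound`. The two hypotheses on e
-- say k/p ≤ e and (p - 1) e ≤ k, the range in which the reduction works.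
[1+e]^p≤pCk[2e]^k : ∀ {e k p} .{{_ : NonZero k}} .{{_ : NonZero p}} → BinomialBound p k →
  fromℕ k ≤ fromℕ p * e → fromℕ (ℕ.pred p) * e ≤ fromℕ k → 0ℚ ≤ e →
  (1ℚ + e) ^ p ≤ fromℕ (p choose k) * (2ℚ * e) ^ k
[1+e]^p≤pCk[2e]^k {e} {suc k′} {suc p′} bound h₁ h₂ 0≤e = *-cancelˡ
  (0<p*q (^-pos p (fromℕ-pos p)) (^-pos k (fromℕ-pos k))) (begin
  P ^ p * K ^ k * (1ℚ + e) ^ p            ≡⟨ solve 3 (λ x y z → x :* y :* z := x :* z :* y) refl (P ^ p) (K ^ k) ((1ℚ + e) ^ p) ⟩
  P ^ p * (1ℚ + e) ^ p * K ^ k            ≡⟨ cong (_* K ^ k) (^-distrib-* P (1ℚ + e) p) ⟨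
  (P * (1ℚ + e)) ^ p * K ^ k              ≤⟨ ratio-bound k′ p′ h₁ h₂ 0≤e ⟩
  (P * e) ^ k * (P + K) ^ p               ≡⟨ cong (_* (P + K) ^ p) (^-distrib-* P e k) ⟩
  P ^ k * e ^ k * (P + K) ^ p             ≡⟨ solve 3 (λ x y z → x :* y :* z := y :* (z :* x)) refl (P ^ k) (e ^ k) ((P + K) ^ p) ⟩
  e ^ k * ((P + K) ^ p * P ^ k)           ≤⟨ *-monoˡ (^-nonNeg k 0≤e) bound-ℚ ⟩
  e ^ k * (N * (2ℚ * K) ^ k * P ^ p)      ≡⟨ cong (λ t → e ^ k * (N * t * P ^ p)) (^-distrib-* 2ℚ K k) ⟩
  e ^ k * (N * (2ℚ ^ k * K ^ k) * P ^ p)  ≡⟨ solve 5 (λ a n t b c → a :* (n :* (t :* b) :* c) := c :* b :* (n :* (t :* a))) refl (e ^ k) N (2ℚ ^ k) (K ^ k) (P ^ p) ⟩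
  P ^ p * K ^ k * (N * (2ℚ ^ k * e ^ k))  ≡⟨ cong (λ t → P ^ p * K ^ k * (N * t)) (^-distrib-* 2ℚ e k) ⟨
  P ^ p * K ^ k * (N * (2ℚ * e) ^ k)      ∎)
  where
    k = suc k′
    p = suc p′
    K = fromℕ k
    P = fromℕ p
    N = fromℕ (p choose k)
    bound-ℚ : (P + K) ^ p * P ^ k ≤ N * (2ℚ * K) ^ k * P ^ p
    bound-ℚ = subst₂ _≤_
      (trans (fromℕ-* ((p ℕ.+ k) ℕ.^ p) (p ℕ.^ k))
        (cong₂ _*_ (trans (fromℕ-^ (p ℕ.+ k) p) (cong (_^ p) (fromℕ-+ p k))) (fromℕ-^ p k)))
      (trans (fromℕ-* ((p choose k) ℕ.* (2 ℕ.* k) ℕ.^ k) (p ℕ.^ p))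
        (cong₂ _*_ (trans (fromℕ-* (p choose k) ((2 ℕ.* k) ℕ.^ k))
          (cong (N *_) (trans (fromℕ-^ (2 ℕ.* k) k) (cong (_^ k) (fromℕ-* 2 k))))) (fromℕ-^ p p)))
      (fromℕ-mono-≤ bound)

-- Averages over a finite index set and over tuples of indices.

sum-mono-≤ : ∀ {n} {f g : Fin n → ℚ} → (∀ i → f i ≤ g i) → sum f ≤ sum g
sum-mono-≤ {zero}  f≤g = ≤-refl
sum-mono-≤ {suc n} f≤g = +-mono-≤ (f≤g Fin.zero) (sum-mono-≤ (f≤g ∘ Fin.suc))

sum-const : ∀ n c → sum {n} (λ _ → c) ≡ fromℕ n * c
sum-const zero    c = sym (*-zeroˡ c)
sum-const (suc n) c = begin-equality
  c + sum {n} (λ _ → c)  ≡⟨ cong (c +_) (sum-const n c) ⟩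
  c + fromℕ n * c        ≡⟨ solve 2 (λ c n → c :+ n :* c := (con 1ℚ :+ n) :* c) refl c (fromℕ n) ⟩
  (1ℚ + fromℕ n) * c     ≡⟨ cong (_* c) (fromℕ-suc n) ⟨
  fromℕ (suc n) * c      ∎

module Average (n : ℕ) .{{_ : NonZero n}} where

  E : (Fin n → ℚ) → ℚ
  E f = (ℤ.+ 1 / n) * sum f

  E-cong : ∀ {f g} → (∀ x → f x ≡ g x) → E f ≡ E g
  E-cong f≗g = cong ((ℤ.+ 1 / n) *_) (sum-cong-≗ f≗g)

  E-mono : ∀ {f g} → (∀ x → f x ≤ g x) → E f ≤ E g
  E-mono f≤g = *-monoˡ (nonNegative⁻¹ (ℤ.+ 1 / n) {{normalize-nonNeg 1 n}}) (sum-mono-≤ f≤g)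

  E-const : ∀ c → E (λ _ → c) ≡ c
  E-const c = begin-equality
    (ℤ.+ 1 / n) * sum {n} (λ _ → c)  ≡⟨ cong ((ℤ.+ 1 / n) *_) (sum-const n c) ⟩
    (ℤ.+ 1 / n) * (fromℕ n * c)      ≡⟨ *-assoc (ℤ.+ 1 / n) (fromℕ n) c ⟨
    (ℤ.+ 1 / n) * fromℕ n * c        ≡⟨ cong (_* c) (m/n*n≡m 1 n) ⟩
    1ℚ * c                           ≡⟨ *-identityˡ c ⟩
    c                                ∎

  E-nonNeg : ∀ {f} → (∀ x → 0ℚ ≤ f x) → 0ℚ ≤ E f
  E-nonNeg 0≤f = ≤-trans (≤-reflexive (sym (E-const 0ℚ))) (E-mono 0≤f)

  E-+ : ∀ f g → E (λ x → f x + g x) ≡ E f + E g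
  E-+ f g = trans (cong ((ℤ.+ 1 / n) *_) (∑-distrib-+ f g)) (*-distribˡ-+ (ℤ.+ 1 / n) (sum f) (sum g))

  E-*ˡ : ∀ c f → E (λ x → c * f x) ≡ c * E f
  E-*ˡ c f = begin-equality
    (ℤ.+ 1 / n) * sum (λ x → c * f x)  ≡⟨ cong ((ℤ.+ 1 / n) *_) (*-distribˡ-sum c f) ⟨
    (ℤ.+ 1 / n) * (c * sum f)          ≡⟨ solve 3 (λ u c s → u :* (c :* s) := c :* (u :* s)) refl (ℤ.+ 1 / n) c (sum f) ⟩
    c * ((ℤ.+ 1 / n) * sum f)          ∎

  E-*ʳ : ∀ c f → E (λ x → f x * c) ≡ E f * c
  E-*ʳ c f = trans (E-cong (λ x → *-comm (f x) c)) (trans (E-*ˡ c f) (*-comm c (E f)))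

  E-comm : ∀ (f : Fin n → Fin n → ℚ) → E (λ x → E λ y → f x y) ≡ E (λ y → E λ x → f x y)
  E-comm f = cong ((ℤ.+ 1 / n) *_) (begin-equality
    sum (λ x → (ℤ.+ 1 / n) * sum λ y → f x y)  ≡⟨ *-distribˡ-sum (ℤ.+ 1 / n) (λ x → sum λ y → f x y) ⟨
    (ℤ.+ 1 / n) * sum (λ x → sum λ y → f x y)  ≡⟨ cong ((ℤ.+ 1 / n) *_) (∑-comm f) ⟩
    (ℤ.+ 1 / n) * sum (λ y → sum λ x → f x y)  ≡⟨ *-distribˡ-sum (ℤ.+ 1 / n) (λ y → sum λ x → f x y) ⟩
    sum (λ y → (ℤ.+ 1 / n) * sum λ x → f x y)  ∎)

  E-permute : ∀ f (π : Permutation′ n) → E f ≡ E (f ∘ (π ⟨$⟩ʳ_))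
  E-permute f π = cong ((ℤ.+ 1 / n) *_) (sum-permute f π)

  -- The average over all j-tuples, taken one coordinate at a time so that each rule for `E` lifts
  -- by induction on j.
  Eⱽ : ∀ j → (Vec (Fin n) j → ℚ) → ℚ
  Eⱽ zero    F = F []
  Eⱽ (suc j) F = E λ y → Eⱽ j λ ys → F (y ∷ ys)

  Eⱽ-cong : ∀ j {F G : Vec (Fin n) j → ℚ} → (∀ ys → F ys ≡ G ys) → Eⱽ j F ≡ Eⱽ j G
  Eⱽ-cong zero    F≗G = F≗G []
  Eⱽ-cong (suc j) F≗G = E-cong λ y → Eⱽ-cong j λ ys → F≗G (y ∷ ys)

  Eⱽ-mono : ∀ j {F G : Vec (Fin n) j → ℚ} → (∀ ys → F ys ≤ G ys) → Eⱽ j F ≤ Eⱽ j G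
  Eⱽ-mono zero    F≤G = F≤G []
  Eⱽ-mono (suc j) F≤G = E-mono λ y → Eⱽ-mono j λ ys → F≤G (y ∷ ys)

  Eⱽ-*ˡ : ∀ j c F → Eⱽ j (λ ys → c * F ys) ≡ c * Eⱽ j F
  Eⱽ-*ˡ zero    c F = refl
  Eⱽ-*ˡ (suc j) c F = trans (E-cong λ y → Eⱽ-*ˡ j c λ ys → F (y ∷ ys)) (E-*ˡ c λ y → Eⱽ j λ ys → F (y ∷ ys))

  Eⱽ-+ : ∀ j F G → Eⱽ j (λ ys → F ys + G ys) ≡ Eⱽ j F + Eⱽ j G
  Eⱽ-+ zero    F G = refl
  Eⱽ-+ (suc j) F G = trans (E-cong λ y → Eⱽ-+ j (F ∘ (y ∷_)) (G ∘ (y ∷_)))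
    (E-+ (λ y → Eⱽ j (F ∘ (y ∷_))) (λ y → Eⱽ j (G ∘ (y ∷_))))

  E-Eⱽ-comm : ∀ j (F : Fin n → Vec (Fin n) j → ℚ) →
    E (λ x → Eⱽ j (F x)) ≡ Eⱽ j λ ys → E λ x → F x ys
  E-Eⱽ-comm zero    F = refl
  E-Eⱽ-comm (suc j) F = trans (E-comm λ x y → Eⱽ j (F x ∘ (y ∷_)))
    (E-cong λ y → E-Eⱽ-comm j λ x → F x ∘ (y ∷_))

  Eⱽ-permute : ∀ j F (π : Permutation′ n) → Eⱽ j F ≡ Eⱽ j (F ∘ map (π ⟨$⟩ʳ_))
  Eⱽ-permute zero    F π = refl
  Eⱽ-permute (suc j) F π = trans (E-permute (λ y → Eⱽ j (F ∘ (y ∷_))) π)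
    (E-cong λ y → Eⱽ-permute j (F ∘ ((π ⟨$⟩ʳ y) ∷_)) π)

  Eⱽ-nonNeg : ∀ j {F} → (∀ ys → 0ℚ ≤ F ys) → 0ℚ ≤ Eⱽ j F
  Eⱽ-nonNeg zero    0≤F = 0≤F []
  Eⱽ-nonNeg (suc j) 0≤F = E-nonNeg λ y → Eⱽ-nonNeg j λ ys → 0≤F (y ∷ ys)

  prod : ∀ {j} → (Fin n → ℚ) → Vec (Fin n) j → ℚ
  prod f []       = 1ℚ
  prod f (y ∷ ys) = f y * prod f ys

  prod-cong : ∀ {j f g} → (∀ y → f y ≡ g y) → (ys : Vec (Fin n) j) → prod f ys ≡ prod g ys
  prod-cong f≗g []       = refl
  prod-cong f≗g (y ∷ ys) = cong₂ _*_ (f≗g y) (prod-cong f≗g ys)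

  prod-* : ∀ {j} f g (ys : Vec (Fin n) j) → prod (λ y → f y * g y) ys ≡ prod f ys * prod g ys
  prod-* f g []       = refl
  prod-* f g (y ∷ ys) = trans (cong (f y * g y *_) (prod-* f g ys))
    (solve 4 (λ a b c d → a :* b :* (c :* d) := a :* c :* (b :* d)) refl (f y) (g y) (prod f ys) (prod g ys))

  prod-map : ∀ {j} f σ (ys : Vec (Fin n) j) → prod f (map σ ys) ≡ prod (f ∘ σ) ys
  prod-map f σ []       = refl
  prod-map f σ (y ∷ ys) = cong (f (σ y) *_) (prod-map f σ ys)

  E^≡Eⱽ : ∀ j f → E f ^ j ≡ Eⱽ j (prod f)
  E^≡Eⱽ zero    f = refl
  E^≡Eⱽ (suc j) f = begin-equality
    E f * E f ^ j                          ≡⟨ cong (E f *_) (E^≡Eⱽ j f) ⟩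
    E f * Eⱽ j (prod f)                    ≡⟨ E-*ʳ (Eⱽ j (prod f)) f ⟨
    E (λ y → f y * Eⱽ j (prod f))          ≡⟨ E-cong (λ y → Eⱽ-*ˡ j (f y) (prod f)) ⟨
    E (λ y → Eⱽ j λ ys → f y * prod f ys)  ∎

  -- Moments of 1 + f for a function f with nonnegative moments.

  module _ (f : Fin n → ℚ) (0≤Ef^ : ∀ j → 0ℚ ≤ E λ x → f x ^ j) where

    -- Interpolates between the moments of f (q = 0) and those of 1 + f (j = 0). Its recursion
    -- mirrors Pascal's rule, so no binomial sum has to be written out.
    mixed : ℕ → ℕ → ℚ
    mixed q j = E λ x → f x ^ j * (1ℚ + f x) ^ q

    mixed-suc : ∀ q j → mixed (suc q) j ≡ mixed q j + mixed q (suc j)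
    mixed-suc q j = trans
      (E-cong λ x → solve 3 (λ f u v → u :* ((con 1ℚ :+ f) :* v) := u :* v :+ f :* u :* v) refl (f x) (f x ^ j) ((1ℚ + f x) ^ q))
      (E-+ (λ x → f x ^ j * (1ℚ + f x) ^ q) (λ x → f x ^ suc j * (1ℚ + f x) ^ q))

    -- All terms C(q,i) E f^(j+i) in the expansion of E f^j (1 + f)^q are nonnegative, so each
    -- single one is a lower bound. The induction on q follows Pascal's rule.
    moment≤mixed : ∀ q k j → fromℕ (q choose k) * E (λ x → f x ^ (j ℕ.+ k)) ≤ mixed q j
    moment≤mixed zero zero j = ≤-reflexive (trans (*-identityˡ _)
      (E-cong λ x → trans (cong (f x ^_) (ℕ.+-identityʳ j)) (sym (*-identityʳ (f x ^ j)))))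
    moment≤mixed zero (suc k) j = begin
      0ℚ * E (λ x → f x ^ (j ℕ.+ suc k))  ≡⟨ *-zeroˡ (E (λ x → f x ^ (j ℕ.+ suc k))) ⟩
      0ℚ                                  ≤⟨ 0≤Ef^ j ⟩
      E (λ x → f x ^ j)                   ≡⟨ E-cong (λ x → *-identityʳ (f x ^ j)) ⟨
      mixed zero j                        ∎
    moment≤mixed (suc q) zero j = begin
      fromℕ (suc q choose 0) * E (λ x → f x ^ (j ℕ.+ 0))  ≡⟨ cong (λ t → fromℕ t * E (λ x → f x ^ (j ℕ.+ 0))) (trans (nC0≡1 (suc q)) (sym (nC0≡1 q))) ⟩
      fromℕ (q choose 0) * E (λ x → f x ^ (j ℕ.+ 0))      ≤⟨ moment≤mixed q zero j ⟩
      mixed q j                                           ≤⟨ p≤p+q (≤-trans (0≤p*q (fromℕ-nonNeg (q choose 0)) (0≤Ef^ (suc j ℕ.+ 0))) (moment≤mixed q zero (suc j))) ⟩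
      mixed q j + mixed q (suc j)                         ≡⟨ mixed-suc q j ⟨
      mixed (suc q) j                                     ∎
    moment≤mixed (suc q) (suc k) j = begin
      fromℕ (suc q choose suc k) * m                                                     ≡⟨ cong (λ t → fromℕ t * m) (nCk+nC[k+1]≡[n+1]C[k+1] q k) ⟨
      fromℕ (q choose k ℕ.+ q choose suc k) * m                                               ≡⟨ cong (_* m) (fromℕ-+ (q choose k) (q choose suc k)) ⟩
      (fromℕ (q choose k) + fromℕ (q choose suc k)) * m                                       ≡⟨ solve 3 (λ u v m → (u :+ v) :* m := v :* m :+ u :* m) refl (fromℕ (q choose k)) (fromℕ (q choose suc k)) m ⟩
      fromℕ (q choose suc k) * m + fromℕ (q choose k) * m                                     ≡⟨ cong (λ t → fromℕ (q choose suc k) * m + fromℕ (q choose k) * E (λ x → f x ^ t)) (ℕ.+-suc j k) ⟩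
      fromℕ (q choose suc k) * m + fromℕ (q choose k) * E (λ x → f x ^ (suc j ℕ.+ k))         ≤⟨ +-mono-≤ (moment≤mixed q (suc k) j) (moment≤mixed q k (suc j)) ⟩
      mixed q j + mixed q (suc j)                                                   ≡⟨ mixed-suc q j ⟨
      mixed (suc q) j                                                               ∎
      where m = E (λ x → f x ^ (j ℕ.+ suc k))

    mixed₀ : ∀ q → mixed q 0 ≡ E λ x → (1ℚ + f x) ^ q
    mixed₀ q = E-cong λ x → *-identityˡ ((1ℚ + f x) ^ q)

    binomial-term≤ : ∀ q k → fromℕ (q choose k) * E (λ x → f x ^ k) ≤ E λ x → (1ℚ + f x) ^ q
    binomial-term≤ q k = ≤-trans (moment≤mixed q k 0) (≤-reflexive (mixed₀ q))

    -- Keeps both the constant and the top term of the expansion. When the right side is at most 1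
    -- this forces the moment of f down to 0, which the top term alone would not do.
    1+moment≤ : ∀ k .{{_ : NonZero k}} → 1ℚ + E (λ x → f x ^ k) ≤ E λ x → (1ℚ + f x) ^ k
    1+moment≤ (suc k) = begin
      1ℚ + m                                                      ≡⟨ cong₂ _+_ (trans (*-identityˡ _) (E-const 1ℚ)) (*-identityˡ m) ⟨
      1ℚ * E (λ _ → 1ℚ) + 1ℚ * m                                  ≡⟨ cong₂ (λ s t → fromℕ s * E (λ _ → 1ℚ) + fromℕ t * m) (nC0≡1 k) (nCn≡1 k) ⟨
      fromℕ (k choose 0) * E (λ _ → 1ℚ) + fromℕ (k choose k) * m  ≤⟨ +-mono-≤ (moment≤mixed k 0 0) (moment≤mixed k k 1) ⟩
      mixed k 0 + mixed k 1                                       ≡⟨ mixed-suc k 0 ⟨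
      mixed (suc k) 0                                             ≡⟨ mixed₀ (suc k) ⟩
      E (λ x → (1ℚ + f x) ^ suc k)                                ∎
      where m = E λ x → f x ^ suc k

  -- Jensen's inequality, by averaging the tangent of y ↦ y^(m+1) at a.
  jensen : ∀ {H w : Fin n → ℚ} {a} m → 0ℚ < a → (∀ x → 0ℚ ≤ H x) → (∀ x → 0ℚ ≤ w x) → E w ≡ 1ℚ →
    E (λ x → H x ^ suc m * w x) ≤ a ^ suc m → E (λ x → H x * w x) ≤ a
  jensen {H} {w} {a} m 0<a 0≤H 0≤w Ew≡1 bound = *-cancelˡ (0<p*q (^-pos m 0<a) (fromℕ-pos (suc m))) (begin
    a ^ m * s * T                                      ≡⟨ solve 4 (λ x s T a → x :* s :* T := x :* (a :- s :* a) :* con 1ℚ :+ x :* s :* T :+ x :* (s :* a :- a)) refl (a ^ m) s T a ⟩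
    a ^ m * (a - s * a) * 1ℚ + a ^ m * s * T + a ^ m * (s * a - a)
      ≡⟨ cong (λ t → a ^ m * (a - s * a) * t + a ^ m * s * T + a ^ m * (s * a - a)) Ew≡1 ⟨
    a ^ m * (a - s * a) * E w + a ^ m * s * T + a ^ m * (s * a - a)
      ≡⟨ cong (_+ a ^ m * (s * a - a)) average ⟨
    E (λ x → a ^ m * (a + s * (H x - a)) * w x) + a ^ m * (s * a - a)
      ≤⟨ +-monoˡ-≤ (a ^ m * (s * a - a)) (≤-trans (E-mono λ x → *-monoʳ (0≤w x) (tangent≤^ m (<⇒≤ 0<a) (0≤H x))) bound) ⟩
    a * a ^ m + a ^ m * (s * a - a)  ≡⟨ solve 3 (λ a x s → a :* x :+ x :* (s :* a :- a) := x :* s :* a) refl a (a ^ m) s ⟩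
    a ^ m * s * a                    ∎)
    where
      s T : ℚ
      s = fromℕ (suc m)
      T = E λ x → H x * w x
      average : E (λ x → a ^ m * (a + s * (H x - a)) * w x) ≡ a ^ m * (a - s * a) * E w + a ^ m * s * T
      average = begin-equality
        E (λ x → a ^ m * (a + s * (H x - a)) * w x)
          ≡⟨ E-cong (λ x → solve 5 (λ y a s h w → y :* (a :+ s :* (h :- a)) :* w := y :* (a :- s :* a) :* w :+ y :* s :* (h :* w)) refl (a ^ m) a s (H x) (w x)) ⟩
        E (λ x → a ^ m * (a - s * a) * w x + a ^ m * s * (H x * w x))
          ≡⟨ E-+ (λ x → a ^ m * (a - s * a) * w x) (λ x → a ^ m * s * (H x * w x)) ⟩
        E (λ x → a ^ m * (a - s * a) * w x) + E (λ x → a ^ m * s * (H x * w x))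
          ≡⟨ cong₂ _+_ (E-*ˡ (a ^ m * (a - s * a)) w) (E-*ˡ (a ^ m * s) (λ x → H x * w x)) ⟩
        a ^ m * (a - s * a) * E w + a ^ m * s * T ∎

  ∣E∣≤E∣∣ : ∀ f → ℚ.∣ E f ∣ ≤ E (λ x → ℚ.∣ f x ∣)
  ∣E∣≤E∣∣ f with ∣p∣≡p∨∣p∣≡-p (E f)
  ... | inj₁ eq = ≤-trans (≤-reflexive eq) (E-mono λ x → p≤∣p∣ (f x))
  ... | inj₂ eq = begin
    ℚ.∣ E f ∣             ≡⟨ eq ⟩
    - E f                 ≡⟨ solve 1 (λ u → :- u := con (- 1ℚ) :* u) refl (E f) ⟩
    - 1ℚ * E f            ≡⟨ E-*ˡ (- 1ℚ) f ⟨
    E (λ x → - 1ℚ * f x)  ≡⟨ E-cong (λ x → solve 1 (λ u → con (- 1ℚ) :* u := :- u) refl (f x)) ⟩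
    E (λ x → - f x)       ≤⟨ E-mono (λ x → ≤-trans (p≤∣p∣ (- f x)) (≤-reflexive (∣-p∣≡∣p∣ (f x)))) ⟩
    E (λ x → ℚ.∣ f x ∣)   ∎

  -- A substitute for Hölder's inequality, whose conjugate exponent k/(k-1) is not an integer.
  weighted-bound : ∀ {H w : Fin n → ℚ} {e} k .{{_ : NonZero k}} → 0ℚ < e →
    (∀ x → 0ℚ ≤ w x) → (∀ x → w x ≤ 2ℚ ^ k) → E w ≡ 1ℚ →
    E (λ x → ℚ.∣ H x ∣ ^ k) ≤ (2ℚ * e) ^ k → ℚ.∣ E (λ x → H x * w x) ∣ ≤ fromℕ 4 * e
  weighted-bound {H} {w} {e} (suc m) 0<e 0≤w w≤2^k Ew≡1 bound = begin
    ℚ.∣ E (λ x → H x * w x) ∣  ≤⟨ ∣E∣≤E∣∣ (λ x → H x * w x) ⟩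
    E (λ x → ℚ.∣ H x * w x ∣)  ≡⟨ E-cong (λ x → trans (∣p*q∣≡∣p∣*∣q∣ (H x) (w x)) (cong (ℚ.∣ H x ∣ *_) (0≤p⇒∣p∣≡p (0≤w x)))) ⟩
    -- Jensen is applied with a = 4e = 2e · 2: replacing w by its bound 2^k multiplies the k-th
    -- moment by 2^k.
    E (λ x → ℚ.∣ H x ∣ * w x)  ≤⟨ jensen m (0<p*q (fromℕ-pos 4) 0<e) (λ x → 0≤∣p∣ (H x)) 0≤w Ew≡1 (begin
      E (λ x → ℚ.∣ H x ∣ ^ k * w x)     ≤⟨ E-mono (λ x → *-monoˡ (^-nonNeg k (0≤∣p∣ (H x))) (w≤2^k x)) ⟩
      E (λ x → ℚ.∣ H x ∣ ^ k * 2ℚ ^ k)  ≡⟨ E-*ʳ (2ℚ ^ k) (λ x → ℚ.∣ H x ∣ ^ k) ⟩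
      E (λ x → ℚ.∣ H x ∣ ^ k) * 2ℚ ^ k  ≤⟨ *-monoʳ (^-nonNeg k (fromℕ-nonNeg 2)) bound ⟩
      (2ℚ * e) ^ k * 2ℚ ^ k             ≡⟨ ^-distrib-* (2ℚ * e) 2ℚ k ⟨
      (2ℚ * e * 2ℚ) ^ k                 ≡⟨ cong (_^ k) (solve 1 (λ e → con 2ℚ :* e :* con 2ℚ := con (fromℕ 4) :* e) refl e) ⟩
      (fromℕ 4 * e) ^ k                 ∎) ⟩
    fromℕ 4 * e                 ∎
    where k = suc m

  -- Convolution and correlation on a finite abelian group.

  module Convolution {_⊕_ : Op₂ (Fin n)} {0# : Fin n} {⊖_ : Op₁ (Fin n)}
    (isAbelianGroup : IsAbelianGroup _≡_ _⊕_ 0# ⊖_) where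
    open IsAbelianGroup isAbelianGroup using (assoc; comm; identityˡ; identityʳ; inverseˡ; inverseʳ)

    infixl 6 _⊝_
    _⊝_ : Op₂ (Fin n)
    x ⊝ y = x ⊕ (⊖ y)

    conv corr : (f g : Fin n → ℚ) → Fin n → ℚ
    conv f g x = E λ y → f y * g (x ⊝ y)
    corr f g x = E λ y → f y * g (x ⊕ y)

    ⊕⊝-cancel : ∀ x t → (x ⊕ t) ⊝ t ≡ x
    ⊕⊝-cancel x t = trans (assoc x t (⊖ t)) (trans (cong (x ⊕_) (inverseʳ t)) (identityʳ x))

    ⊝⊕-cancel : ∀ x t → (x ⊝ t) ⊕ t ≡ x
    ⊝⊕-cancel x t = trans (assoc x (⊖ t) t) (trans (cong (x ⊕_) (inverseˡ t)) (identityʳ x))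

    translation : Fin n → Permutation′ n
    translation t = permutation (_⊕ t) (_⊝ t) (λ x → ⊝⊕-cancel x t) (λ x → ⊕⊝-cancel x t)

    reflection : Fin n → Permutation′ n
    reflection x = permutation (x ⊝_) (x ⊝_) involutive involutive
      where
        involutive : ∀ y → x ⊝ (x ⊝ y) ≡ y
        involutive y = trans (cong (_⊝ (x ⊝ y)) (sym (trans (comm y (x ⊝ y)) (⊝⊕-cancel x y))))
          (⊕⊝-cancel y (x ⊝ y))

    E-translate : ∀ f t → E (λ x → f (x ⊕ t)) ≡ E f
    E-translate f t = sym (E-permute f (translation t))

    Φ Φ⁻ : ∀ {j} → (Fin n → ℚ) → Vec (Fin n) j → ℚ
    Φ  g ys = E λ x → prod (λ y → g (x ⊕ y)) ys
    Φ⁻ g ys = E λ x → prod (λ y → g (x ⊝ y)) ys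

    -- A common shift of all entries of ys is absorbed by a shift of the averaging variable x.
    Φ-translate : ∀ {j} g t (ys : Vec (Fin n) j) → Φ g (map (_⊕ t) ys) ≡ Φ g ys
    Φ-translate g t ys = begin-equality
      E (λ x → prod (λ y → g (x ⊕ y)) (map (_⊕ t) ys))  ≡⟨ E-cong (λ x → prod-map (λ y → g (x ⊕ y)) (_⊕ t) ys) ⟩
      E (λ x → prod (λ y → g (x ⊕ (y ⊕ t))) ys)         ≡⟨ E-cong (λ x → prod-cong (λ y → cong g (rearrange x y)) ys) ⟩
      E (λ x → prod (λ y → g ((x ⊕ t) ⊕ y)) ys)         ≡⟨ E-translate (λ x → prod (λ y → g (x ⊕ y)) ys) t ⟩
      Φ g ys                                            ∎
      where
        rearrange : ∀ x y → x ⊕ (y ⊕ t) ≡ (x ⊕ t) ⊕ y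
        rearrange x y = trans (cong (x ⊕_) (comm y t)) (sym (assoc x t y))

    Φ⁻-translate : ∀ {j} g t (ys : Vec (Fin n) j) → Φ⁻ g (map (_⊕ t) ys) ≡ Φ⁻ g ys
    Φ⁻-translate g t ys = begin-equality
      E (λ x → prod (λ y → g (x ⊝ y)) (map (_⊕ t) ys))  ≡⟨ E-cong (λ x → prod-map (λ y → g (x ⊝ y)) (_⊕ t) ys) ⟩
      E (λ x → prod (λ y → g (x ⊝ (y ⊕ t))) ys)         ≡⟨ E-translate (λ x → prod (λ y → g (x ⊝ (y ⊕ t))) ys) t ⟨
      E (λ x → prod (λ y → g ((x ⊕ t) ⊝ (y ⊕ t))) ys)   ≡⟨ E-cong (λ x → prod-cong (λ y → cong g (cancel x y)) ys) ⟩
      Φ⁻ g ys                                           ∎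
      where
        cancel : ∀ x y → (x ⊕ t) ⊝ (y ⊕ t) ≡ x ⊝ y
        cancel x y = trans
          (cong (_⊝ (y ⊕ t)) (trans (cong (_⊕ t) (sym (⊝⊕-cancel x y))) (assoc (x ⊝ y) y t)))
          (⊕⊝-cancel (x ⊝ y) (y ⊕ t))

    -- The average over ys is unchanged when all entries are shifted by t, hence also when one
    -- averages over t. As Ψ is constant under such shifts, only `prod g` is averaged over t, which
    -- yields `Φ g`.
    symmetrise : ∀ j g (Ψ : Vec (Fin n) j → ℚ) → (∀ t ys → Ψ (map (_⊕ t) ys) ≡ Ψ ys) →
      Eⱽ j (λ ys → prod g ys * Ψ ys) ≡ Eⱽ j (λ ys → Φ g ys * Ψ ys)
    symmetrise j g Ψ Ψ-translate = begin-equality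
      Eⱽ j F                                                  ≡⟨ E-const (Eⱽ j F) ⟨
      E (λ t → Eⱽ j F)                                        ≡⟨ E-cong (λ t → Eⱽ-permute j F (translation t)) ⟩
      E (λ t → Eⱽ j λ ys → F (map (_⊕ t) ys))                 ≡⟨ E-cong (λ t → Eⱽ-cong j λ ys → cong₂ _*_ (shift t ys) (Ψ-translate t ys)) ⟩
      E (λ t → Eⱽ j λ ys → prod (λ y → g (t ⊕ y)) ys * Ψ ys)  ≡⟨ E-Eⱽ-comm j (λ t ys → prod (λ y → g (t ⊕ y)) ys * Ψ ys) ⟩
      Eⱽ j (λ ys → E λ t → prod (λ y → g (t ⊕ y)) ys * Ψ ys)  ≡⟨ Eⱽ-cong j (λ ys → E-*ʳ (Ψ ys) (λ t → prod (λ y → g (t ⊕ y)) ys)) ⟩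
      Eⱽ j (λ ys → Φ g ys * Ψ ys)                             ∎
      where
        F : Vec (Fin n) j → ℚ
        F ys = prod g ys * Ψ ys
        shift : ∀ t ys → prod g (map (_⊕ t) ys) ≡ prod (λ y → g (t ⊕ y)) ys
        shift t ys = trans (prod-map g (_⊕ t) ys) (prod-cong (λ y → cong g (comm y t)) ys)

    -- Serves correlation and convolution alike, with `h x y` of the form g (x + y) or g (x - y).
    moment : ∀ j f (h : Fin n → Fin n → ℚ) →
      E (λ x → E (λ y → f y * h x y) ^ j) ≡ Eⱽ j (λ ys → prod f ys * E λ x → prod (h x) ys)
    moment j f h = begin-equality
      E (λ x → E (λ y → f y * h x y) ^ j)              ≡⟨ E-cong (λ x → E^≡Eⱽ j (λ y → f y * h x y)) ⟩
      E (λ x → Eⱽ j (prod λ y → f y * h x y))          ≡⟨ E-cong (λ x → Eⱽ-cong j λ ys → prod-* f (h x) ys) ⟩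
      E (λ x → Eⱽ j λ ys → prod f ys * prod (h x) ys)  ≡⟨ E-Eⱽ-comm j (λ x ys → prod f ys * prod (h x) ys) ⟩
      Eⱽ j (λ ys → E λ x → prod f ys * prod (h x) ys)  ≡⟨ Eⱽ-cong j (λ ys → E-*ˡ (prod f ys) (λ x → prod (h x) ys)) ⟩
      Eⱽ j (λ ys → prod f ys * E λ x → prod (h x) ys)  ∎

    corr-moment : ∀ j g → E (λ x → corr g g x ^ j) ≡ Eⱽ j (λ ys → Φ g ys * Φ g ys)
    corr-moment j g = trans (moment j g (λ x y → g (x ⊕ y))) (symmetrise j g (Φ g) (Φ-translate g))

    conv-moment : ∀ j g h → E (λ x → conv g h x ^ j) ≡ Eⱽ j (λ ys → Φ g ys * Φ⁻ h ys)
    conv-moment j g h = trans (moment j g (λ x y → h (x ⊝ y))) (symmetrise j g (Φ⁻ h) (Φ⁻-translate h))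

    corr-moment-nonNeg : ∀ g j → 0ℚ ≤ E λ x → corr g g x ^ j
    corr-moment-nonNeg g j = subst (0ℚ ≤_) (sym (corr-moment j g)) (Eⱽ-nonNeg j λ ys → 0≤p*p (Φ g ys))

    -- Replacing every entry of ys by its negative is a bijection that turns `Φ` into `Φ⁻`.
    corr-moment⁻ : ∀ j g → E (λ x → corr g g x ^ j) ≡ Eⱽ j (λ ys → Φ⁻ g ys * Φ⁻ g ys)
    corr-moment⁻ j g = begin-equality
      E (λ x → corr g g x ^ j)                                   ≡⟨ corr-moment j g ⟩
      Eⱽ j (λ ys → Φ g ys * Φ g ys)                              ≡⟨ Eⱽ-permute j (λ ys → Φ g ys * Φ g ys) (reflection 0#) ⟩
      Eⱽ j (λ ys → Φ g (map (0# ⊝_) ys) * Φ g (map (0# ⊝_) ys))  ≡⟨ Eⱽ-cong j (λ ys → cong (λ t → t * t) (Φ-reflect ys)) ⟩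
      Eⱽ j (λ ys → Φ⁻ g ys * Φ⁻ g ys)                            ∎
      where
        Φ-reflect : ∀ {j} (ys : Vec (Fin n) j) → Φ g (map (0# ⊝_) ys) ≡ Φ⁻ g ys
        Φ-reflect ys = E-cong λ x → trans (prod-map (λ y → g (x ⊕ y)) (0# ⊝_) ys)
          (prod-cong (λ y → cong (λ z → g (x ⊕ z)) (identityˡ (⊖ y))) ys)

    -- The pointwise inequality 2ab ≤ a² + b² stands in for Cauchy-Schwarz and avoids square roots.
    -- Nothing is lost when both correlation moments obey the same bound.
    decoupling : ∀ j g h →
      2ℚ * E (λ x → conv g h x ^ j) ≤ E (λ x → corr g g x ^ j) + E (λ x → corr h h x ^ j)
    decoupling j g h = begin
      2ℚ * E (λ x → conv g h x ^ j)                                    ≡⟨ cong (2ℚ *_) (conv-moment j g h) ⟩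
      2ℚ * Eⱽ j (λ ys → Φ g ys * Φ⁻ h ys)                              ≡⟨ Eⱽ-*ˡ j 2ℚ (λ ys → Φ g ys * Φ⁻ h ys) ⟨
      Eⱽ j (λ ys → 2ℚ * (Φ g ys * Φ⁻ h ys))                            ≤⟨ Eⱽ-mono j (λ ys → 2ab≤a²+b² (Φ g ys) (Φ⁻ h ys)) ⟩
      Eⱽ j (λ ys → Φ g ys * Φ g ys + Φ⁻ h ys * Φ⁻ h ys)                ≡⟨ Eⱽ-+ j (λ ys → Φ g ys * Φ g ys) (λ ys → Φ⁻ h ys * Φ⁻ h ys) ⟩
      Eⱽ j (λ ys → Φ g ys * Φ g ys) + Eⱽ j (λ ys → Φ⁻ h ys * Φ⁻ h ys)  ≡⟨ cong₂ _+_ (corr-moment j g) (corr-moment⁻ j h) ⟨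
      E (λ x → corr g g x ^ j) + E (λ x → corr h h x ^ j)              ∎
      where
        2ab≤a²+b² : ∀ a b → 2ℚ * (a * b) ≤ a * a + b * b
        2ab≤a²+b² a b = ≤-trans (p≤p+q (0≤p*p (a - b)))
          (≤-reflexive (solve 2 (λ a b → con 2ℚ :* (a :* b) :+ (a :- b) :* (a :- b) := a :* a :+ b :* b) refl a b))

    module _ {f g : Fin n → ℚ} (Ef≡1 : E f ≡ 1ℚ) (Eg≡1 : E g ≡ 1ℚ) where

      -- Here π is y ↦ x - y or y ↦ y + x. As a permutation it preserves the mean of g, so the
      -- expansion of (f - 1)(g ∘ π - 1) averages to E (f · (g ∘ π)) - 1 - 1 + 1.
      E-centre : (π : Permutation′ n) →
        1ℚ + E (λ y → (f y - 1ℚ) * (g (π ⟨$⟩ʳ y) - 1ℚ)) ≡ E (λ y → f y * g (π ⟨$⟩ʳ y))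
      E-centre π = begin-equality
        1ℚ + E (λ y → (f y - 1ℚ) * (g (σ y) - 1ℚ))                              ≡⟨ solve 1 (λ u → con 1ℚ :+ u := u :+ con 1ℚ :+ con 1ℚ :- con 1ℚ) refl (E (λ y → (f y - 1ℚ) * (g (σ y) - 1ℚ))) ⟩
        E (λ y → (f y - 1ℚ) * (g (σ y) - 1ℚ)) + 1ℚ + 1ℚ - 1ℚ                    ≡⟨ cong₂ (λ s t → E (λ y → (f y - 1ℚ) * (g (σ y) - 1ℚ)) + s + t - 1ℚ) Ef≡1 (trans (sym (E-permute g π)) Eg≡1) ⟨
        E (λ y → (f y - 1ℚ) * (g (σ y) - 1ℚ)) + E f + E (g ∘ σ) - 1ℚ            ≡⟨ cong₂ _+_ (trans (E-+ _ _) (cong (_+ E (g ∘ σ)) (E-+ _ _))) (E-const (- 1ℚ)) ⟨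
        E (λ y → (f y - 1ℚ) * (g (σ y) - 1ℚ) + f y + g (σ y)) + E (λ _ → - 1ℚ)  ≡⟨ E-+ _ _ ⟨
        E (λ y → (f y - 1ℚ) * (g (σ y) - 1ℚ) + f y + g (σ y) - 1ℚ)              ≡⟨ E-cong (λ y → solve 2 (λ a b → (a :- con 1ℚ) :* (b :- con 1ℚ) :+ a :+ b :- con 1ℚ := a :* b) refl (f y) (g (σ y))) ⟩
        E (λ y → f y * g (σ y))                                                 ∎
        where
          σ : Fin n → Fin n
          σ = π ⟨$⟩ʳ_

      conv-centre : ∀ x → 1ℚ + conv (λ y → f y - 1ℚ) (λ y → g y - 1ℚ) x ≡ conv f g x
      conv-centre x = E-centre (reflection x)

      corr-centre : ∀ x → 1ℚ + corr (λ y → f y - 1ℚ) (λ y → g y - 1ℚ) x ≡ corr f g x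
      corr-centre x = subst (λ s → 1ℚ + s ≡ corr f g x) (E-cong λ y → cong (λ z → (f y - 1ℚ) * (g z - 1ℚ)) (comm y x))
        (trans (E-centre (translation x)) (E-cong λ y → cong (λ z → f y * g z) (comm y x)))

    centred : (Fin n → ℚ) → Fin n → ℚ
    centred f x = f x - 1ℚ

    AutocorrelationBound : (Fin n → ℚ) → ℕ → ℚ → Set
    AutocorrelationBound f k e = E (λ x → corr (centred f) (centred f) x ^ k) ≤ (2ℚ * e) ^ k

    module _ {f : Fin n → ℚ} (Ef≡1 : E f ≡ 1ℚ) where
      private
        F : Fin n → ℚ
        F = corr (centred f) (centred f)

        E[1+F]^q≤ : ∀ q → E (λ x → (1ℚ + F x) ^ q) ≤ E (λ x → ℚ.∣ corr f f x ∣ ^ q)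
        E[1+F]^q≤ q = E-mono λ x → subst (λ t → t ^ q ≤ ℚ.∣ corr f f x ∣ ^ q) (sym (corr-centre Ef≡1 Ef≡1 x))
          (p^n≤∣p∣^n (corr f f x) q)

      autocorrelationBound : ∀ {e k p} .{{_ : NonZero k}} .{{_ : NonZero p}} → BinomialBound p k →
        fromℕ k ≤ fromℕ p * e → fromℕ (ℕ.pred p) * e ≤ fromℕ k → 0ℚ ≤ e →
        E (λ x → ℚ.∣ corr f f x ∣ ^ p) ≤ (1ℚ + e) ^ p → AutocorrelationBound f k e
      autocorrelationBound {e} {k} {p} bound h₁ h₂ 0≤e regular =
        *-cancelˡ (fromℕ-pos (p choose k) {{binomialBound⇒nonZero bound}}) (begin
          fromℕ (p choose k) * E (λ x → F x ^ k)  ≤⟨ binomial-term≤ F (corr-moment-nonNeg (centred f)) p k ⟩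
          E (λ x → (1ℚ + F x) ^ p)                ≤⟨ E[1+F]^q≤ p ⟩
          E (λ x → ℚ.∣ corr f f x ∣ ^ p)          ≤⟨ regular ⟩
          (1ℚ + e) ^ p                            ≤⟨ [1+e]^p≤pCk[2e]^k bound h₁ h₂ 0≤e ⟩
          fromℕ (p choose k) * (2ℚ * e) ^ k       ∎)

      autocorrelationBound-∞ : ∀ {e k} .{{_ : NonZero k}} → 0ℚ ≤ e →
        (∀ x → ℚ.∣ corr f f x ∣ ≤ 1ℚ) → AutocorrelationBound f k e
      autocorrelationBound-∞ {e} {k} 0≤e regular = begin
        m            ≡⟨ solve 1 (λ m → m := con 1ℚ :+ m :- con 1ℚ) refl m ⟩
        1ℚ + m - 1ℚ  ≤⟨ +-monoˡ-≤ (- 1ℚ) (begin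
          1ℚ + m                          ≤⟨ 1+moment≤ F (corr-moment-nonNeg (centred f)) k ⟩
          E (λ x → (1ℚ + F x) ^ k)        ≤⟨ E[1+F]^q≤ k ⟩
          E (λ x → ℚ.∣ corr f f x ∣ ^ k)  ≤⟨ E-mono (λ x → ^-mono-≤ k (0≤∣p∣ (corr f f x)) (regular x)) ⟩
          E (λ x → 1ℚ ^ k)                ≡⟨ trans (E-const (1ℚ ^ k)) (1^n≡1 k) ⟩
          1ℚ                              ∎) ⟩
        1ℚ - 1ℚ       ≤⟨ ^-nonNeg k (0≤p*q (fromℕ-nonNeg 2) 0≤e) ⟩
        (2ℚ * e) ^ k  ∎
        where m = E λ x → F x ^ k

    convolution-bound : ∀ {f g k e} → E f ≡ 1ℚ → E g ≡ 1ℚ → 2 ∣ k →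
      AutocorrelationBound f k e → AutocorrelationBound g k e →
      E (λ x → ℚ.∣ conv f g x - 1ℚ ∣ ^ k) ≤ (2ℚ * e) ^ k
    convolution-bound {f} {g} {k} {e} Ef≡1 Eg≡1 2∣k bound-f bound-g = *-cancelˡ (fromℕ-pos 2) (begin
      2ℚ * E (λ x → ℚ.∣ conv f g x - 1ℚ ∣ ^ k)           ≡⟨ cong (2ℚ *_) (E-cong λ x → trans (∣p∣^n≡p^n (conv f g x - 1ℚ) 2∣k) (cong (_^ k) (centre x))) ⟩
      2ℚ * E (λ x → conv (centred f) (centred g) x ^ k)  ≤⟨ decoupling k (centred f) (centred g) ⟩
      E (λ x → corr (centred f) (centred f) x ^ k) + E (λ x → corr (centred g) (centred g) x ^ k)
                                                            ≤⟨ +-mono-≤ bound-f bound-g ⟩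
      (2ℚ * e) ^ k + (2ℚ * e) ^ k  ≡⟨ solve 1 (λ u → u :+ u := con 2ℚ :* u) refl ((2ℚ * e) ^ k) ⟩
      2ℚ * (2ℚ * e) ^ k            ∎)
      where
        centre : ∀ x → conv f g x - 1ℚ ≡ conv (centred f) (centred g) x
        centre x = trans (cong (_- 1ℚ) (sym (conv-centre Ef≡1 Eg≡1 x)))
          (solve 1 (λ u → con 1ℚ :+ u :- con 1ℚ := u) refl (conv (centred f) (centred g) x))

-- Sums and maxima over finite index sets.

nonempty⇒nonZero : ∀ {n} {S : Subset n} → Nonempty S → NonZero ∣ S ∣
nonempty⇒nonZero {S = inside  ∷ S} _                = _
nonempty⇒nonZero {S = outside ∷ S} (_ , there i∈S) = nonempty⇒nonZero (_ , i∈S)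

sum-indicator : ∀ {n} (S : Subset n) v → sum (λ i → if lookup S i then v else 0ℚ) ≡ v * fromℕ ∣ S ∣
sum-indicator []            v = sym (*-zeroʳ v)
sum-indicator (outside ∷ S) v = trans (+-identityˡ _) (sum-indicator S v)
sum-indicator (inside  ∷ S) v = begin-equality
  v + sum (λ i → if lookup S i then v else 0ℚ)  ≡⟨ cong (v +_) (sum-indicator S v) ⟩
  v + v * fromℕ ∣ S ∣                           ≡⟨ solve 2 (λ v s → v :+ v :* s := v :* (con 1ℚ :+ s)) refl v (fromℕ ∣ S ∣) ⟩
  v * (1ℚ + fromℕ ∣ S ∣)                        ≡⟨ cong (v *_) (fromℕ-suc ∣ S ∣) ⟨
  v * fromℕ (suc ∣ S ∣)                         ∎

foldr-⊔-≥ : ∀ {n} (f : Fin n → ℚ) i → f i ≤ foldr _⊔_ 0ℚ f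
foldr-⊔-≥ f Fin.zero    = p≤p⊔q (f Fin.zero) _
foldr-⊔-≥ f (Fin.suc i) = ≤-trans (foldr-⊔-≥ (f ∘ Fin.suc) i) (p≤q⊔p (f Fin.zero) _)

-- Passing between a real number ε and its rational upper bounds e.

<⇒lower-*ᴿ : ∀ {c ε r s} → r < s → (∀ e → upper ε e → s ≤ c * e) → lower (c *ᴿ ε) r
<⇒lower-*ᴿ {c} {ε} r<s s≤ce with located (c *ᴿ ε) r<s
... | inj₁ lr = lr
-- An upper bound s of c ε would come with some e above ε such that c e < s, against the hypothesis.
... | inj₂ (_ , e , _ , ue , _ , ce<s) = contradiction (≤-<-trans (s≤ce e ue) ce<s) (<-irrefl refl)

fromℚ≤*ᴿ : ∀ {c ε q} → (∀ e → upper ε e → q ≤ c * e) → fromℚ q ≤ᴿ c *ᴿ ε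
fromℚ≤*ᴿ {c} {ε} q≤ce r r<q = <⇒lower-*ᴿ {c} {ε} r<q q≤ce

root≤*ᴿ : ∀ {c ε k q 0≤q} .{{_ : NonZero k}} → (∀ e → upper ε e → 0ℚ ≤ c * e) →
  (∀ e → upper ε e → q ≤ (c * e) ^ k) → root k q 0≤q ≤ᴿ c *ᴿ ε
root≤*ᴿ {c} {ε} {k} 0≤ce q≤[ce]^k r (s , r<s , 0≤s , s^k≤q) =
  <⇒lower-*ᴿ {c} {ε} r<s λ e ue → ^-cancel-≤ k (0≤ce e ue) (≤-trans s^k≤q (q≤[ce]^k e ue))

-- Choose e′ with ε < e′ < e. If (1 + e)^p < q, then 1 + e′ lies strictly below the root, so e′
-- would lie below ε.
root≤1+ᴿ : ∀ {ε p q 0≤q e} .{{_ : NonZero p}} → root p q 0≤q ≤ᴿ 1ℚ +ᴿ ε → upper ε e → 0ℚ ≤ e →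
  q ≤ (1ℚ + e) ^ p
root≤1+ᴿ {ε} {p} {q} {e = e} root≤ ue 0≤e with upper-open ε ue
... | e′ , e′<e , ue′ = ≮⇒≥ λ [1+e]^p<q → <-irrefl refl
  (lower<upper ε
    (subst (lower ε) (solve 1 (λ e → con 1ℚ :+ e :+ con (- 1ℚ) := e) refl e′)
      (root≤ (1ℚ + e′) (1ℚ + e , +-monoʳ-< 1ℚ e′<e , +-mono-≤ 0≤1 0≤e , <⇒≤ [1+e]^p<q)))
    ue′)

0≤ᴿ⇒0≤upper : ∀ {ε e} → 0ᴿ ≤ᴿ ε → upper ε e → 0ℚ ≤ e
0≤ᴿ⇒0≤upper {ε} {e} 0≤ε ue = ≮⇒≥ λ e<0 → <-irrefl refl (lower<upper ε (0≤ε e e<0) ue)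

0≤ᴿ⇒0<upper : ∀ {ε e} → 0ᴿ ≤ᴿ ε → upper ε e → 0ℚ < e
0≤ᴿ⇒0<upper {ε} 0≤ε ue with upper-open ε ue
... | e′ , e′<e , ue′ = ≤-<-trans (0≤ᴿ⇒0≤upper {ε} 0≤ε ue′) e′<e

-- Comes from k/ε ≤ p: if p e < k, then e would witness p < k/ε.
ceiling-lower : ∀ {k p ε e} .{{_ : NonZero k}} (0<ε : 0ᴿ <ᴿ ε) → IsCeiling (quotientᴿ k ε 0<ε) p →
  upper ε e → fromℕ k ≤ fromℕ p * e
ceiling-lower {k} {p} {ε} {e} 0<ε@(z , 0<z , lz) (_ , k/ε≤p) ue = ≮⇒≥ λ pe<k → <-irrefl refl
  (k/ε≤p (fromℕ p) (e , <-trans 0<z (lower<upper ε lz ue) , ue , subst (_< fromℕ k) (*-comm (fromℕ p) e) pe<k))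

-- The strict inequality p - 1 < k/ε leaves room for some e above ε, but larger upper bounds of ε
-- may violate (p - 1) e ≤ k.
ceiling-upper : ∀ {k p ε} .{{_ : NonZero k}} .{{_ : NonZero p}} (0<ε : 0ᴿ <ᴿ ε) → IsCeiling (quotientᴿ k ε 0<ε) p →
  ∃ λ e → upper ε e × fromℕ (ℕ.pred p) * e ≤ fromℕ k
ceiling-upper {k} {suc p} {ε} 0<ε@(z , 0<z , lz) ((q , p<q , s , 0<s , us , sq<k) , _) = s , us , (begin
  fromℕ p * s                 ≡⟨ solve 2 (λ p s → p :* s := s :* (con 1ℚ :+ p :+ con (- 1ℚ))) refl (fromℕ p) s ⟩
  s * (1ℚ + fromℕ p + - 1ℚ)   ≡⟨ cong (λ t → s * (t + - 1ℚ)) (fromℕ-suc p) ⟨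
  s * (fromℕ (suc p) + - 1ℚ)  ≤⟨ *-monoˡ (<⇒≤ 0<s) (<⇒≤ p<q) ⟩
  s * q                       ≤⟨ <⇒≤ sq<k ⟩
  fromℕ k                     ∎)

fromℕ-mono-< : ∀ {m n} → m ℕ.< n → fromℕ m < fromℕ n
fromℕ-mono-< {m} {n} m<n = begin-strict
  fromℕ m        ≡⟨ +-identityˡ (fromℕ m) ⟨
  0ℚ + fromℕ m   <⟨ +-monoˡ-< (fromℕ m) (toWitness {a? = 0ℚ <? 1ℚ} tt) ⟩
  1ℚ + fromℕ m   ≡⟨ fromℕ-suc m ⟨
  fromℕ (suc m)  ≤⟨ fromℕ-mono-≤ m<n ⟩
  fromℕ n        ∎

-- In effect k/p ≤ ε ≤ 1/4. If p < 4k then 1/4 < k/p, and locating ε between these two contradicts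
-- either ε ≤ 1/4 or k ≤ p e for some e with ε < e < k/p.
4k≤p : ∀ {k p ε} .{{_ : NonZero p}} → ε ≤ᴿ fromℚ (ℤ.+ 1 / 4) →
  (∀ e → upper ε e → fromℕ k ≤ fromℕ p * e) → 4 ℕ.* k ℕ.≤ p
4k≤p {k} {p} {ε} ε≤¼ k≤pe = ℕ.≮⇒≥ λ p<4k → absurd (¼<k/p p<4k)
  where
    k/p : ℚ
    k/p = ℤ.+ k / p
    p*k/p : fromℕ p * k/p ≡ fromℕ k
    p*k/p = trans (*-comm (fromℕ p) k/p) (m/n*n≡m k p)
    ¼<k/p : p ℕ.< 4 ℕ.* k → ℤ.+ 1 / 4 < k/p
    ¼<k/p p<4k = *-cancelˡ-<-nonNeg (fromℕ p) {{nonNegative (fromℕ-nonNeg p)}} (begin-strict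
      fromℕ p * (ℤ.+ 1 / 4)            <⟨ *-monoˡ-<-pos (ℤ.+ 1 / 4) (fromℕ-mono-< p<4k) ⟩
      fromℕ (4 ℕ.* k) * (ℤ.+ 1 / 4)    ≡⟨ cong (_* (ℤ.+ 1 / 4)) (fromℕ-* 4 k) ⟩
      fromℕ 4 * fromℕ k * (ℤ.+ 1 / 4)  ≡⟨ solve 1 (λ k → con (fromℕ 4) :* k :* con (ℤ.+ 1 / 4) := k) refl (fromℕ k) ⟩
      fromℕ k                          ≡⟨ p*k/p ⟨
      fromℕ p * k/p                    ∎)
    absurd : ¬ (ℤ.+ 1 / 4 < k/p)
    absurd ¼<k/p with located ε ¼<k/p
    ... | inj₁ l = <-irrefl refl (ε≤¼ _ l)
    ... | inj₂ u with upper-open ε u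
    ...   | e , e<k/p , ue = <-irrefl refl (begin-strict
      fromℕ k        ≤⟨ k≤pe e ue ⟩
      fromℕ p * e    <⟨ *-monoʳ-<-pos (fromℕ p) {{positive (fromℕ-pos p)}} e<k/p ⟩
      fromℕ p * k/p  ≡⟨ p*k/p ⟩
      fromℕ k        ∎)

-- Transport of the group and its density functions to the index set.

module Transport {c ℓ : Level} (G : FiniteAbelianGroup c ℓ) where
  open FiniteAbelianGroup G
  open AbelianGroup abelianGroup using (_≈_; ∙-congˡ)
    renaming (rawGroup to rawᴳ; isAbelianGroup to isAbelianGroupᴳ)
  open Average order

  index-cong : ∀ {x y} → x ≈ y → index x ≡ index y
  index-cong = Inverse.to-cong enumeration

  index-element : ∀ i → index (element i) ≡ i
  index-element = Inverse.strictlyInverseˡ enumeration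

  element-index : ∀ x → element (index x) ≈ x
  element-index = Inverse.strictlyInverseʳ enumeration

  -- Carrying the operations over to indices replaces the setoid equality of G by propositional
  -- equality, as the averages over `Fin order` require.
  raw : RawGroup _ _
  raw = record
    { Carrier = Fin order
    ; _≈_     = _≡_
    ; _∙_     = λ i j → index (element i +ᴳ element j)
    ; ε       = index 0ᴳ
    ; _⁻¹     = λ i → index (-ᴳ element i)
    }

  open RawGroup raw using () renaming (_∙_ to _⊕_; ε to 0#; _⁻¹ to ⊖_)

  isAbelianGroup : IsAbelianGroup _≡_ _⊕_ 0# ⊖_
  isAbelianGroup = GroupMonomorphism.isAbelianGroup {G₁ = raw} {G₂ = rawᴳ} {⟦_⟧ = element} (record
    { isGroupHomomorphism = record
      { isMonoidHomomorphism = record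
        { isMagmaHomomorphism = record
          { isRelHomomorphism = record { cong = Inverse.from-cong enumeration }
          ; homo = λ i j → element-index (element i +ᴳ element j)
          }
        ; ε-homo = element-index 0ᴳ
        }
      ; ⁻¹-homo = λ i → element-index (-ᴳ element i)
      }
    ; injective = λ {i} {j} i≈j → trans (sym (index-element i)) (trans (index-cong i≈j) (index-element j))
    }) isAbelianGroupᴳ

  open Convolution isAbelianGroup

  module _ (S : Subset order) (S≢∅ : Nonempty S) where
    private
      instance
        ∣S∣≢0 : NonZero ∣ S ∣
        ∣S∣≢0 = nonempty⇒nonZero S≢∅

      v : ℚ
      v = ℤ.+ order / ∣ S ∣

      0≤v : 0ℚ ≤ v
      0≤v = nonNegative⁻¹ v {{normalize-nonNeg order ∣ S ∣}}

    index-density : Fin order → ℚ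
    index-density i = if lookup S i then v else 0ℚ

    density-element : ∀ i → density S S≢∅ (element i) ≡ index-density i
    density-element i = cong index-density (index-element i)

    E-index-density : E index-density ≡ 1ℚ
    E-index-density = begin-equality
      (ℤ.+ 1 / order) * sum index-density  ≡⟨ cong ((ℤ.+ 1 / order) *_) (sum-indicator S v) ⟩
      (ℤ.+ 1 / order) * (v * fromℕ ∣ S ∣)  ≡⟨ cong ((ℤ.+ 1 / order) *_) (m/n*n≡m order ∣ S ∣) ⟩
      (ℤ.+ 1 / order) * fromℕ order        ≡⟨ m/n*n≡m 1 order ⟩
      1ℚ                                   ∎

    index-density-nonNeg : ∀ i → 0ℚ ≤ index-density i
    index-density-nonNeg i with lookup S i
    ... | true  = 0≤v
    ... | false = ≤-refl

    index-density≤2^k : ∀ k → ½ ^ k * fromℕ order ≤ fromℕ ∣ S ∣ → ∀ i → index-density i ≤ 2ℚ ^ k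
    index-density≤2^k k large i with lookup S i
    ... | false = ^-nonNeg k (fromℕ-nonNeg 2)
    ... | true  = *-cancelˡ (0<p*q (^-pos k (toWitness {a? = 0ℚ <? ½} tt)) (fromℕ-pos ∣ S ∣)) (begin
      ½ ^ k * s * v        ≡⟨ trans (*-assoc (½ ^ k) s v) (cong (½ ^ k *_) (trans (*-comm s v) (m/n*n≡m order ∣ S ∣))) ⟩
      ½ ^ k * fromℕ order  ≤⟨ large ⟩
      s                    ≡⟨ trans (cong (_* s) (1^n≡1 k)) (*-identityˡ s) ⟨
      (½ * 2ℚ) ^ k * s     ≡⟨ cong (_* s) (^-distrib-* ½ 2ℚ k) ⟩
      ½ ^ k * 2ℚ ^ k * s   ≡⟨ solve 3 (λ x y s → x :* y :* s := x :* s :* y) refl (½ ^ k) (2ℚ ^ k) s ⟩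
      ½ ^ k * s * 2ℚ ^ k   ∎)
      where s = fromℕ ∣ S ∣

  module _ (S T : Subset order) (S≢∅ : Nonempty S) (T≢∅ : Nonempty T) where

    ⋆-element : ∀ i → (density S S≢∅ ⋆ density T T≢∅) (element i) ≡ corr (index-density S S≢∅) (index-density T T≢∅) i
    ⋆-element i = E-cong λ j → cong (_* index-density T T≢∅ (i ⊕ j)) (density-element S S≢∅ j)

    ⊛-element : ∀ i → (density S S≢∅ ⊛ density T T≢∅) (element i) ≡ conv (index-density S S≢∅) (index-density T T≢∅) i
    ⊛-element i = E-cong λ j → cong₂ _*_ (density-element S S≢∅ j)
      (cong (index-density T T≢∅) (sym (index-cong (∙-congˡ (element-index (-ᴳ element j))))))

  selfRegular⇒autocorrelationBound : ∀ {A} (A≢∅ : Nonempty A) {ε} → 0ᴿ ≤ᴿ ε → ε ≤ᴿ fromℚ (ℤ.+ 1 / 4) →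
    ∀ {k} .{{_ : NonZero k}} → 2 ℕ.≤ k → ∀ {p} → IsCeilingOfRatio k ε p → SelfRegular A A≢∅ (1ℚ +ᴿ ε) p →
    ∀ e → upper ε e → AutocorrelationBound (index-density A A≢∅) k e
  selfRegular⇒autocorrelationBound {A} A≢∅ {ε} 0≤ε ε≤¼ {k} 2≤k {fin p} (finite 0<ε ceiling) regular = bound
    where
      k≤pe : ∀ e → upper ε e → fromℕ k ≤ fromℕ p * e
      k≤pe e = ceiling-lower {k} {p} {ε} 0<ε ceiling
      bound-below : ∀ e → upper ε e → fromℕ (ℕ.pred p) * e ≤ fromℕ k →
        AutocorrelationBound (index-density A A≢∅) k e
      bound-below e ue [p-1]e≤k = autocorrelationBound (E-index-density A A≢∅)
        (binomialBound 2≤k (4k≤p {k} {p} {ε} ε≤¼ k≤pe)) (k≤pe e ue) [p-1]e≤k (0≤ᴿ⇒0≤upper {ε} 0≤ε ue)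
        (begin
          E (λ i → ℚ.∣ corr (index-density A A≢∅) (index-density A A≢∅) i ∣ ^ p)
            ≡⟨ E-cong (λ i → cong (λ t → ℚ.∣ t ∣ ^ p) (⋆-element A A A≢∅ A≢∅ i)) ⟨
          E (λ i → ℚ.∣ (density A A≢∅ ⋆ density A A≢∅) (element i) ∣ ^ p)
            ≤⟨ root≤1+ᴿ {ε}
                 {0≤q = E-nonNeg λ i → ^-nonNeg p (0≤∣p∣ ((density A A≢∅ ⋆ density A A≢∅) (element i)))}
                 regular ue (0≤ᴿ⇒0≤upper {ε} 0≤ε ue) ⟩
          (1ℚ + e) ^ p ∎)
      bound : ∀ e → upper ε e → AutocorrelationBound (index-density A A≢∅) k e
      bound e ue with ceiling-upper {k} {p} {ε} 0<ε ceiling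
      -- For e ≤ e₀ the inequality (p - 1) e ≤ k is inherited from e₀; for larger e the bound at e₀
      -- is already the stronger one.
      ... | e₀ , ue₀ , [p-1]e₀≤k with ≤-total e e₀
      ...   | inj₁ e≤e₀ = bound-below e ue (≤-trans (*-monoˡ (fromℕ-nonNeg (ℕ.pred p)) e≤e₀) [p-1]e₀≤k)
      ...   | inj₂ e₀≤e = ≤-trans (bound-below e₀ ue₀ [p-1]e₀≤k)
        (^-mono-≤ k (0≤p*q (fromℕ-nonNeg 2) (0≤ᴿ⇒0≤upper {ε} 0≤ε ue₀)) (*-monoˡ (fromℕ-nonNeg 2) e₀≤e))
  selfRegular⇒autocorrelationBound {A} A≢∅ {ε} 0≤ε ε≤¼ {k} 2≤k {∞} (infinite (ε≤0 , _)) regular e ue =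
    autocorrelationBound-∞ (E-index-density A A≢∅) (0≤ᴿ⇒0≤upper {ε} 0≤ε ue) λ i → begin
      ℚ.∣ corr (index-density A A≢∅) (index-density A A≢∅) i ∣  ≡⟨ cong ℚ.∣_∣ (⋆-element A A A≢∅ A≢∅ i) ⟨
      ℚ.∣ (density A A≢∅ ⋆ density A A≢∅) (element i) ∣         ≤⟨ foldr-⊔-≥ (λ i → ℚ.∣ (density A A≢∅ ⋆ density A A≢∅) (element i) ∣) i ⟩
      maximum                                                   ≤⟨ ≮⇒≥ maximum≯1 ⟩
      1ℚ                                                        ∎
    where
      maximum : ℚ
      maximum = foldr _⊔_ 0ℚ λ i → ℚ.∣ (density A A≢∅ ⋆ density A A≢∅) (element i) ∣
      maximum≯1 : ¬ (1ℚ < maximum)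
      maximum≯1 1<max with <-dense 1<max
      -- Self-regularity would put q - 1 > 0 below ε, and ε ≤ 0.
      ... | q , 1<q , q<max = <-asym (+-monoˡ-< (- 1ℚ) 1<q) (ε≤0 (q + - 1ℚ) (regular q q<max))

  -- The two estimates for a pair of self-regular sets.

  module SelfRegularPair {A B} (A≢∅ : Nonempty A) (B≢∅ : Nonempty B)
    {ε} (0≤ε : 0ᴿ ≤ᴿ ε) (ε≤¼ : ε ≤ᴿ fromℚ (ℤ.+ 1 / 4)) {k : ℕ} .{{_ : NonZero k}} (2∣k : 2 ∣ k) (2≤k : 2 ℕ.≤ k)
    {p} (ratio : IsCeilingOfRatio k ε p)
    (regular-A : SelfRegular A A≢∅ (1ℚ +ᴿ ε) p) (regular-B : SelfRegular B B≢∅ (1ℚ +ᴿ ε) p) where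

    private
      a b : Fin order → ℚ
      a = index-density A A≢∅
      b = index-density B B≢∅

    moment-bound : ∀ e → upper ε e → E (λ i → ℚ.∣ conv a b i - 1ℚ ∣ ^ k) ≤ (2ℚ * e) ^ k
    moment-bound e ue = convolution-bound {e = e} (E-index-density A A≢∅) (E-index-density B B≢∅) 2∣k
      (selfRegular⇒autocorrelationBound A≢∅ {ε} 0≤ε ε≤¼ 2≤k ratio regular-A e ue)
      (selfRegular⇒autocorrelationBound B≢∅ {ε} 0≤ε ε≤¼ 2≤k ratio regular-B e ue)

    norm-bound : ∥ (λ x → (density A A≢∅ ⊛ density B B≢∅) x - 1ℚ) ∥ (fin k) ≤ᴿ fromℕ 2 *ᴿ ε
    norm-bound = root≤*ᴿ {fromℕ 2} {ε}
      {0≤q = E-nonNeg λ i → ^-nonNeg k (0≤∣p∣ ((density A A≢∅ ⊛ density B B≢∅) (element i) - 1ℚ))}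
      (λ e ue → 0≤p*q (fromℕ-nonNeg 2) (0≤ᴿ⇒0≤upper {ε} 0≤ε ue)) λ e ue → begin
      E (λ i → ℚ.∣ (density A A≢∅ ⊛ density B B≢∅) (element i) - 1ℚ ∣ ^ k)
        ≡⟨ E-cong (λ i → cong (λ t → ℚ.∣ t - 1ℚ ∣ ^ k) (⊛-element A B A≢∅ B≢∅ i)) ⟩
      E (λ i → ℚ.∣ conv a b i - 1ℚ ∣ ^ k)
        ≤⟨ moment-bound e ue ⟩
      (2ℚ * e) ^ k ∎

    -- Since C has mean 1, subtracting 1 from the inner product amounts to pairing C with A * B - 1.
    -- The size of C bounds this weight by 2^k, so `weighted-bound` turns the k-th moment bound into
    -- 4e.
    inner-product-bound : (C : Subset order) (C≢∅ : Nonempty C) → ½ ^ k * fromℕ order ≤ fromℕ ∣ C ∣ →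
      fromℚ ℚ.∣ ⟨ density A A≢∅ ⊛ density B B≢∅ , density C C≢∅ ⟩ - 1ℚ ∣ ≤ᴿ fromℕ 4 *ᴿ ε
    inner-product-bound C C≢∅ large = fromℚ≤*ᴿ {fromℕ 4} {ε} λ e ue → subst (λ t → ℚ.∣ t ∣ ≤ fromℕ 4 * e) centre
      (weighted-bound k (0≤ᴿ⇒0<upper {ε} 0≤ε ue) (index-density-nonNeg C C≢∅) (index-density≤2^k C C≢∅ k large)
        (E-index-density C C≢∅) (moment-bound e ue))
      where
        w : Fin order → ℚ
        w = index-density C C≢∅
        centre : E (λ i → (conv a b i - 1ℚ) * w i) ≡ ⟨ density A A≢∅ ⊛ density B B≢∅ , density C C≢∅ ⟩ - 1ℚ
        centre = begin-equality
          E (λ i → (conv a b i - 1ℚ) * w i)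
            ≡⟨ E-cong (λ i → solve 2 (λ u w → (u :- con 1ℚ) :* w := u :* w :+ con (- 1ℚ) :* w) refl (conv a b i) (w i)) ⟩
          E (λ i → conv a b i * w i + - 1ℚ * w i)
            ≡⟨ E-+ (λ i → conv a b i * w i) (λ i → - 1ℚ * w i) ⟩
          E (λ i → conv a b i * w i) + E (λ i → - 1ℚ * w i)
            ≡⟨ cong₂ _+_ (E-cong λ i → cong₂ _*_ (⊛-element A B A≢∅ B≢∅ i) (density-element C C≢∅ i))
                 (trans (sym (cong (- 1ℚ *_) (E-index-density C C≢∅))) (sym (E-*ˡ (- 1ℚ) w))) ⟨
          ⟨ density A A≢∅ ⊛ density B B≢∅ , density C C≢∅ ⟩ - 1ℚ ∎

open Transport using (module SelfRegularPair)

open import Data.Integer.Base using (+_)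

theorem2p11 : (c ℓ : Level) → Σ[ K ∈ ℚ ] (
    (G : FiniteAbelianGroup c ℓ) → let open FiniteAbelianGroup G in
    (A B : Subset order) (A≢∅ : Nonempty A) (B≢∅ : Nonempty B) →
    (ε : ℝ) → 0ᴿ ≤ᴿ ε → ε ≤ᴿ fromℚ (+ 1 / 4) →
    (k : ℕ) .{{_ : NonZero k}} → 2 ∣ k → 2 ℕ.≤ k →
    (p : Exponent) → IsCeilingOfRatio k ε p →
    SelfRegular A A≢∅ (1ℚ +ᴿ ε) p →
    SelfRegular B B≢∅ (1ℚ +ᴿ ε) p →
    ∥ (λ x → (density A A≢∅ ⊛ density B B≢∅) x - 1ℚ) ∥ (fin k) ≤ᴿ fromℕ 2 *ᴿ ε
    × ((C : Subset order) (C≢∅ : Nonempty C) →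
    ½ ^ k * fromℕ order ℚ.≤ fromℕ ∣ C ∣ →
    fromℚ ℚ.∣ ⟨ density A A≢∅ ⊛ density B B≢∅ , density C C≢∅ ⟩ - 1ℚ ∣ ≤ᴿ K *ᴿ ε))
theorem2p11 c ℓ = fromℕ 4 , λ G A B A≢∅ B≢∅ ε 0≤ε ε≤¼ k 2∣k 2≤k p ratio regular-A regular-B →
  let open SelfRegularPair G A≢∅ B≢∅ {ε} 0≤ε ε≤¼ 2∣k 2≤k ratio regular-A regular-B
  in norm-bound , inner-product-bound
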